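{- There exists a $3$-connected planar graph $G$ that is not a complete graph and that is not degree-truncated $8$-choosable.
   Context: All graphs are finite and simple. A list assignment $L$ of a graph $G$ assigns to each vertex $v$ a set $L(v)$ of colours; an $L$-colouring is a map $\phi$ with $\phi(v)\in L(v)$ for all $v$ and $\phi(u)\neq\phi(v)$ for every edge $uv$. For $f:V(G)\to\mathbb{N}$, an $f$-list assignment is a list assignment with $|L(v)|\ge f(v)$ for all $v$, and $G$ is $f$-choosable if it is $L$-colourable for every $f$-list assignment $L$. For a positive integer $k$, $G$ is degree-truncated $k$-choosable if $G$ is $f$-choosable for $f(v)=\min\{k,d_G(v)\}$, where $d_G(v)$ is the degree of $v$ in $G$. -}

module Defs where

open import Level using (0ℓ)
open import Data.Nat using (ℕ; _<_; _≤_; _⊓_)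
open import Data.Fin as Fin using (Fin)
open import Data.Fin.Subset using (Subset; _∈_; _∉_; ∣_∣)
open import Data.List using (List; []; _∷_; length; filter; allFin)
open import Data.Rational as ℚ using (ℚ; 0ℚ; 1ℚ)
open import Data.Product using (Σ-syntax; ∃-syntax; _×_; _,_; proj₁; proj₂)
open import Data.Sum using (_⊎_)
open import Function.Definitions using (Injective)
open import Relation.Binary using (Rel; Decidable; Symmetric; Irreflexive)
open import Relation.Binary.Construct.Closure.ReflexiveTransitive using (Star)
open import Relation.Binary.PropositionalEquality using (_≡_; _≢_)

record Graph : Set₁ where
  field
    order  : ℕ
    Adj    : Rel (Fin order) 0ℓ
    Adj?   : Decidable Adj
    sym    : Symmetric Adj
    irrefl : Irreflexive _≡_ Adj

  Vertex : Set
  Vertex = Fin order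

  degree : Vertex → ℕ
  degree v = length (filter (Adj? v) (allFin order))

  -- Each unordered edge is listed once, smaller endpoint first.
  Edge : Set
  Edge = Σ[ (u , v) ∈ Vertex × Vertex ] u Fin.< v × Adj u v

  ends : Edge → Vertex × Vertex
  ends = proj₁

open Graph

Complete : Graph → Set
Complete G = ∀ {u v : Vertex G} → u ≢ v → Adj G u v

-- Connectedness of G − S.  The walk relation lives on all vertices, so that
-- the empty walk needs no equality between proofs of u ∉ S.
ConnectedOutside : (G : Graph) → Subset (order G) → Set
ConnectedOutside G S =
  ∀ {u v} → u ∉ S → v ∉ S →
  Star (λ x y → Adj G x y × x ∉ S × y ∉ S) u v

_-Connected_ : ℕ → Graph → Set
k -Connected G =
  k < order G × (∀ (S : Subset (order G)) → ∣ S ∣ < k → ConnectedOutside G S)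

-- On a finite graph finite lists use only finitely many
-- colours altogether, so they are subsets of a palette Fin c with c arbitrary.

ListAssignment : Graph → ℕ → Set
ListAssignment G c = Vertex G → Subset c

IsListAssignmentFor : (G : Graph) (f : Vertex G → ℕ) {c : ℕ} →
                      ListAssignment G c → Set
IsListAssignmentFor G f L = ∀ v → f v ≤ ∣ L v ∣

Colourable : (G : Graph) {c : ℕ} → ListAssignment G c → Set
Colourable G {c} L =
  Σ[ φ ∈ (Vertex G → Fin c) ]
    (∀ v → φ v ∈ L v) × (∀ {u v} → Adj G u v → φ u ≢ φ v)

Choosable : (G : Graph) → (Vertex G → ℕ) → Set
Choosable G f =
  ∀ {c} (L : ListAssignment G c) → IsListAssignmentFor G f L → Colourable G L

DegreeTruncatedChoosable : ℕ → Graph → Set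
DegreeTruncatedChoosable k G = Choosable G (λ v → k ⊓ degree G v)

-- Planarity: a crossing-free drawing in which the edges are polygonal arcs.
-- Coordinates are rational.  Two segments with rational endpoints that meet
-- in the real plane already meet in a rational point, so such a drawing is
-- crossing-free in ℝ² as well; conversely a planar graph has one, since a
-- polygonal drawing can be perturbed to rational coordinates.

Point : Set
Point = ℚ × ℚ

lerp : Point → Point → ℚ → Point
lerp (a , b) (c , d) t =
  a ℚ.+ t ℚ.* (c ℚ.- a) , b ℚ.+ t ℚ.* (d ℚ.- b)

OnSegment : Point → Point → Point → Set
OnSegment p q x = ∃[ t ] 0ℚ ℚ.≤ t × t ℚ.≤ 1ℚ × x ≡ lerp p q t

-- The list holds the successive bends of the line from p to q.
OnPolyline : Point → List Point → Point → Point → Set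
OnPolyline p []       q x = OnSegment p q x
OnPolyline p (b ∷ bs) q x = OnSegment p b x ⊎ OnPolyline b bs q x

-- The line has no self-intersections: each segment meets the remainder of
-- the line only in the bend where they are joined.
IsArc : Point → List Point → Point → Set
IsArc p []       q = p ≢ q
IsArc p (b ∷ bs) q =
  p ≢ b ×
  (∀ x → OnSegment p b x → OnPolyline b bs q x → x ≡ b) ×
  IsArc b bs q

record Drawing (G : Graph) : Set where
  field
    position : Vertex G → Point
    bends    : Edge G → List Point

  source target : Edge G → Point
  source e = position (proj₁ (ends G e))
  target e = position (proj₂ (ends G e))

  On : Edge G → Point → Set
  On e x = OnPolyline (source e) (bends e) (target e) x

  EndOf : Edge G → Point → Set
  EndOf e x = x ≡ source e ⊎ x ≡ target e

record IsPlane {G : Graph} (D : Drawing G) : Set where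
  open Drawing D
  field
    position-injective : Injective _≡_ _≡_ position
    arcs               : ∀ e → IsArc (source e) (bends e) (target e)
    avoids-vertices    : ∀ e w → On e (position w) → EndOf e (position w)
    no-crossings       : ∀ e f → ends G e ≢ ends G f →
                         ∀ x → On e x → On f x → EndOf e x × EndOf f x

Planar : Graph → Set
Planar G = Σ[ D ∈ Drawing G ] IsPlane D

{-# OPTIONS --safe #-}
-- Two adjacent vertices, the apexes, are joined to every vertex of a sequence of mids.  The triangle
-- formed by an apex and two consecutive mids is a cell, whose inside holds five vertices of small
-- degree: a hub joined to both mids, and on the side of each mid two adjacent vertices ("top" and
-- "in") joined to that mid and to the hub, the top one also to the apex.  If the left pair has lists
-- S ∪ {a} and S, the right pair S' ∪ {a} and S', and the hub S ∪ S', with |S| = |S'| = 3, then no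
-- colouring gives the apex colour a, the left mid a colour in S and the right mid a colour in S':
-- the left mid and pair use up S, the right mid and pair use up S', and nothing is left for the hub.
--
-- The apexes and the even mids have the list {0,…,7}.  Each pair (a , b) of apex colours is excluded
-- by a lens of four cells on three mids.  Let S₀ and S₁ be the halves of {0,…,7} ∖ {a,b}, and let
-- {a,b} ∪ M ∪ M' with |M| = |M'| = 3 be the list of the middle mid.  The cells before it exclude
-- S₀ × M and S₁ × M, which forces its colour into M'; those after it exclude M' × S₀ and M' × S₁,
-- which leaves no colour for the next mid.
--
-- In the drawing all edges are straight.  Edges of different cells are separated by the axis carrying
-- the mids or by a line through an apex.
module Submission where

open import Data.Empty using (⊥)
open import Data.Fin as Fin using (Fin; zero; suc; inject₁; toℕ; fromℕ<)
open import Data.Fin.Induction using (<-weakInduction)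
open import Data.Fin.Patterns
import Data.Fin.Properties as Fin
open import Data.Fin.Subset as Subset using (Subset; _∈_; _∉_; ∣_∣; _─_; _∪_; ⁅_⁆; inside; outside)
open import Data.Fin.Subset.Properties
  using (_∈?_; x∈p⇒∣p-x∣<∣p∣; x∈p∧x≢y⇒x∈p-y; x∈p∧x∉q⇒x∈p─q; x∈p∪q⁻; x∈⁅y⁆⇒x≡y)
open import Data.Integer as ℤ using (ℤ; +_)
open import Data.List using (List; []; _∷_; length; allFin; map; _++_)
open import Data.List.Membership.Propositional using () renaming (_∈_ to _∈ₗ_)
open import Data.List.Membership.Propositional.Properties
  using (∈-filter⁻; ∈-map⁺; ∈-∃++; ∈-++⁻; ∈-++⁺ˡ; ∈-++⁺ʳ)
open import Data.List.Properties using (length-map; length-++)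
open import Data.List.Relation.Unary.All as All using (All; []; _∷_)
open import Data.List.Relation.Unary.AllPairs using ([]; _∷_)
open import Data.List.Relation.Unary.Any as Any using (Any; here; there)
open import Data.List.Relation.Unary.Unique.Propositional using (Unique)
open import Data.List.Relation.Unary.Unique.Propositional.Properties using (allFin⁺; filter⁺)
open import Data.Nat as ℕ using (ℕ; zero; suc; z≤n; s≤s)
open import Data.Nat.DivMod using (_mod_)
import Data.Nat.Properties as ℕ
open import Data.Product using (Σ-syntax; ∃-syntax; ∃; _×_; _,_; proj₁; proj₂)
open import Data.Product.Function.NonDependent.Propositional using (_×-↔_)
import Data.Product.Properties as Product
open import Data.Rational as ℚ using (ℚ; 0ℚ; 1ℚ; ½; _+_; _*_; _-_; -_; _/_; _≤_; _<_)
import Data.Rational.Properties as ℚ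
open import Data.Rational.Solver using (module +-*-Solver)
open import Data.Sum as Sum using (_⊎_; inj₁; inj₂)
open import Data.Sum.Function.Propositional using (_⊎-↔_)
open import Data.Unit using (⊤; tt)
open import Data.Vec using (Vec; []; _∷_; lookup)
open import Function using (_∘_; _↔_; mk↔ₛ′; Inverse; id)
open import Function.Construct.Composition using (_↔-∘_)
open import Function.Construct.Identity using (↔-id)
open import Function.Definitions using (Injective)
open import Relation.Binary using (DecidableEquality; tri<; tri≈; tri>)
open import Relation.Binary.Construct.Closure.ReflexiveTransitive as Star using (Star; ε; _◅_; _◅◅_)
open import Relation.Binary.PropositionalEquality
open import Relation.Nullary using (¬_; Dec; yes; no; contradiction)
open import Relation.Nullary.Decidable
  using (_×-dec_; _⊎-dec_; _→-dec_; ¬?; map′; from-yes; decidable-stable)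
open import Relation.Unary as Unary using ()
open import Defs

-- Exhaustive search and counting

Searchable : Set → Set₁
Searchable A = ∀ {P : A → Set} → Unary.Decidable P → Dec (∃ P)

⊤-searchable : Searchable ⊤
⊤-searchable P? = map′ (tt ,_) proj₂ (P? tt)

Fin-searchable : ∀ {n} → Searchable (Fin n)
Fin-searchable = Fin.any?

⊎-searchable : ∀ {A B} → Searchable A → Searchable B → Searchable (A ⊎ B)
⊎-searchable search-A search-B P? =
  map′ (λ { (inj₁ (a , p)) → inj₁ a , p ; (inj₂ (b , p)) → inj₂ b , p })
       (λ { (inj₁ a , p) → inj₁ (a , p) ; (inj₂ b , p) → inj₂ (b , p) })
       (search-A (P? ∘ inj₁) ⊎-dec search-B (P? ∘ inj₂))

×-searchable : ∀ {A B} → Searchable A → Searchable B → Searchable (A × B)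
×-searchable search-A search-B P? =
  map′ (λ (a , b , p) → (a , b) , p) (λ ((a , b) , p) → a , b , p)
       (search-A (λ a → search-B (λ b → P? (a , b))))

-- Removing the head from `S` lowers its size and, without repetitions, keeps the tail inside. This
-- is the pigeonhole behind both 3-connectedness and the colouring contradiction.
unique⇒length≤∣_∣ : ∀ {n} (S : Subset n) {xs} → Unique xs → All (_∈ S) xs → length xs ℕ.≤ ∣ S ∣
unique⇒length≤∣ S ∣ [] [] = z≤n
unique⇒length≤∣ S ∣ (x∉xs ∷ unique) (x∈S ∷ xs⊆S) =
  ℕ.≤-<-trans (unique⇒length≤∣ S Subset.- _ ∣ unique (All.zipWith drop (x∉xs , xs⊆S))) (x∈p⇒∣p-x∣<∣p∣ x∈S)
  where
  drop : ∀ {y} → _ ≢ y × y ∈ S → y ∈ S Subset.- _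
  drop (x≢y , y∈S) = x∈p∧x≢y⇒x∈p-y y∈S (x≢y ∘ sym)

unique-⊆⇒length≤ : ∀ {A : Set} {xs ys : List A} → Unique xs →
                   (∀ {x} → x ∈ₗ xs → x ∈ₗ ys) → length xs ℕ.≤ length ys
unique-⊆⇒length≤ [] _ = z≤n
unique-⊆⇒length≤ {xs = x ∷ xs} (x∉xs ∷ unique) xs⊆ys with ∈-∃++ (xs⊆ys (here refl))
... | ys , zs , refl = subst (suc (length xs) ℕ.≤_) (sym shift) (s≤s (unique-⊆⇒length≤ unique rest))
  where
  shift : length (ys ++ x ∷ zs) ≡ suc (length (ys ++ zs))
  shift = trans (length-++ ys) (trans (ℕ.+-suc _ _) (cong suc (sym (length-++ ys))))

  rest : ∀ {y} → y ∈ₗ xs → y ∈ₗ ys ++ zs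
  rest y∈xs with ∈-++⁻ ys (xs⊆ys (there y∈xs))
  ... | inj₁ y∈ys = ∈-++⁺ˡ y∈ys
  ... | inj₂ (here refl) = contradiction refl (All.lookup x∉xs y∈xs)
  ... | inj₂ (there y∈zs) = ∈-++⁺ʳ ys y∈zs

-- Cells

pattern hub = 0F
pattern leftTop = 1F
pattern leftIn = 2F
pattern rightTop = 3F
pattern rightIn = 4F

data Spot : Set where
  top left right : Spot
  inner : Fin 5 → Spot

-- Only edges with an inner end, each listed once with an inner vertex as tail. The border edges
-- from the apex to the mids can belong to two cells and are introduced separately as spokes;
-- consecutive mids are not joined.
bondEnds : Vec (Fin 5 × Spot) 14
bondEnds =
  (hub , left) ∷ (hub , right) ∷
  (leftTop , top) ∷ (leftTop , left) ∷ (leftTop , inner leftIn) ∷ (leftTop , inner hub) ∷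
  (leftIn , left) ∷ (leftIn , inner hub) ∷
  (rightTop , top) ∷ (rightTop , right) ∷ (rightTop , inner rightIn) ∷ (rightTop , inner hub) ∷
  (rightIn , right) ∷ (rightIn , inner hub) ∷ []

bondTail : Fin 14 → Fin 5
bondTail e = proj₁ (lookup bondEnds e)

bondHead : Fin 14 → Spot
bondHead e = proj₂ (lookup bondEnds e)

inner-injective : ∀ {i i'} → inner i ≡ inner i' → i ≡ i'
inner-injective refl = refl

_≟ₛ_ : DecidableEquality Spot
top ≟ₛ top = yes refl
top ≟ₛ left = no λ ()
top ≟ₛ right = no λ ()
top ≟ₛ inner _ = no λ ()
left ≟ₛ top = no λ ()
left ≟ₛ left = yes refl
left ≟ₛ right = no λ ()
left ≟ₛ inner _ = no λ ()
right ≟ₛ top = no λ ()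
right ≟ₛ left = no λ ()
right ≟ₛ right = yes refl
right ≟ₛ inner _ = no λ ()
inner _ ≟ₛ top = no λ ()
inner _ ≟ₛ left = no λ ()
inner _ ≟ₛ right = no λ ()
inner i ≟ₛ inner i' = map′ (cong inner) inner-injective (i Fin.≟ i')

bond-proper : ∀ e → bondHead e ≢ inner (bondTail e)
bond-proper = from-yes (Fin.all? λ e → ¬? (bondHead e ≟ₛ inner (bondTail e)))

-- Agreement with `bondEnds` is checked by enumeration below. The lengths 6, 4, 3, 4, 3 bound the
-- degrees and are the sizes that the colour lists must reach.
neighbours : Fin 5 → List Spot
neighbours hub = left ∷ right ∷ inner leftTop ∷ inner leftIn ∷ inner rightTop ∷ inner rightIn ∷ []
neighbours leftTop = top ∷ left ∷ inner leftIn ∷ inner hub ∷ []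
neighbours leftIn = left ∷ inner leftTop ∷ inner hub ∷ []
neighbours rightTop = top ∷ right ∷ inner rightIn ∷ inner hub ∷ []
neighbours rightIn = right ∷ inner rightTop ∷ inner hub ∷ []

bondHead∈neighbours : ∀ e → bondHead e ∈ₗ neighbours (bondTail e)
bondHead∈neighbours = from-yes (Fin.all? λ e → Any.any? (bondHead e ≟ₛ_) (neighbours (bondTail e)))

bondTail∈neighbours : ∀ e i → bondHead e ≡ inner i → inner (bondTail e) ∈ₗ neighbours i
bondTail∈neighbours = from-yes (Fin.all? λ e → Fin.all? λ i →
  (bondHead e ≟ₛ inner i) →-dec Any.any? (inner (bondTail e) ≟ₛ_) (neighbours i))

IsBond : Fin 5 → Spot → Set
IsBond i σ = ∃[ e ] ((bondTail e ≡ i × bondHead e ≡ σ) ⊎ (inner (bondTail e) ≡ σ × bondHead e ≡ inner i))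

isBond? : ∀ i σ → Dec (IsBond i σ)
isBond? i σ = Fin.any? λ e →
  (bondTail e Fin.≟ i ×-dec bondHead e ≟ₛ σ) ⊎-dec (inner (bondTail e) ≟ₛ σ ×-dec bondHead e ≟ₛ inner i)

neighbour-bond : ∀ i σ → σ ∈ₗ neighbours i → IsBond i σ
neighbour-bond i σ = All.lookup (from-yes (Fin.all? λ i → All.all? (isBond? i) (neighbours i)) i)

-- Plane geometry

neg-involutive : ∀ x → - (- x) ≡ x
neg-involutive = solve 1 (λ x → :- (:- x) := x) refl
  where open +-*-Solver

x<y⇒0<y-x : ∀ {x y} → x < y → 0ℚ < y - x
x<y⇒0<y-x {x} {y} x<y = subst (_< y - x) (ℚ.+-inverseʳ x) (ℚ.+-monoˡ-< (- x) x<y)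

x≤y⇒0≤y-x : ∀ {x y} → x ≤ y → 0ℚ ≤ y - x
x≤y⇒0≤y-x {x} {y} x≤y = subst (_≤ y - x) (ℚ.+-inverseʳ x) (ℚ.+-monoˡ-≤ (- x) x≤y)

+-nonneg : ∀ {x y} → 0ℚ ≤ x → 0ℚ ≤ y → 0ℚ ≤ x + y
+-nonneg = ℚ.+-mono-≤

+-pos-nonneg : ∀ {x y} → 0ℚ < x → 0ℚ ≤ y → 0ℚ < x + y
+-pos-nonneg = ℚ.+-mono-<-≤

+-nonneg-pos : ∀ {x y} → 0ℚ ≤ x → 0ℚ < y → 0ℚ < x + y
+-nonneg-pos = ℚ.+-mono-≤-<

*-nonneg : ∀ {x y} → 0ℚ ≤ x → 0ℚ ≤ y → 0ℚ ≤ x * y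
*-nonneg {x} {y} 0≤x 0≤y =
  ℚ.nonNegative⁻¹ _ ⦃ ℚ.nonNeg*nonNeg⇒nonNeg x ⦃ ℚ.nonNegative 0≤x ⦄ y ⦃ ℚ.nonNegative 0≤y ⦄ ⦄

*-pos : ∀ {x y} → 0ℚ < x → 0ℚ < y → 0ℚ < x * y
*-pos {x} {y} 0<x 0<y =
  ℚ.positive⁻¹ _ ⦃ ℚ.pos*pos⇒pos x ⦃ ℚ.positive 0<x ⦄ y ⦃ ℚ.positive 0<y ⦄ ⦄

Functional : Set
Functional = ℚ × ℚ × ℚ

⟦_⟧ : Functional → Point → ℚ
⟦ a , b , c ⟧ (x , y) = a + (b * x + c * y)

negate : Functional → Functional
negate (a , b , c) = - a , - b , - c

⟦negate⟧ : ∀ g p → ⟦ negate g ⟧ p ≡ - ⟦ g ⟧ p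
⟦negate⟧ (a , b , c) (x , y) = solve 5
  (λ a b c x y → :- a :+ (:- b :* x :+ :- c :* y) := :- (a :+ (b :* x :+ c :* y))) refl a b c x y
  where open +-*-Solver

⟦⟧-lerp : ∀ g p q t → ⟦ g ⟧ (lerp p q t) ≡ (1ℚ - t) * ⟦ g ⟧ p + t * ⟦ g ⟧ q
⟦⟧-lerp (a , b , c) (x , y) (x' , y') t = solve 8
  (λ a b c x y x' y' t →
     a :+ (b :* (x :+ t :* (x' :- x)) :+ c :* (y :+ t :* (y' :- y)))
     := (con 1ℚ :- t) :* (a :+ (b :* x :+ c :* y)) :+ t :* (a :+ (b :* x' :+ c :* y')))
  refl a b c x y x' y' t
  where open +-*-Solver

lerp-0 : ∀ p q → lerp p q 0ℚ ≡ p
lerp-0 (a , b) (c , d) = cong₂ _,_ (lemma a c) (lemma b d)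
  where
  open +-*-Solver
  lemma : ∀ a c → a + 0ℚ * (c - a) ≡ a
  lemma = solve 2 (λ a c → a :+ con 0ℚ :* (c :- a) := a) refl

lerp-1 : ∀ p q → lerp p q 1ℚ ≡ q
lerp-1 (a , b) (c , d) = cong₂ _,_ (lemma a c) (lemma b d)
  where
  open +-*-Solver
  lemma : ∀ a c → a + 1ℚ * (c - a) ≡ c
  lemma = solve 2 (λ a c → a :+ con 1ℚ :* (c :- a) := c) refl

OnSegment-sym : ∀ {p q x} → OnSegment p q x → OnSegment q p x
OnSegment-sym {a , b} {c , d} (t , 0≤t , t≤1 , eq) =
  1ℚ - t , x≤y⇒0≤y-x t≤1 ,
  subst (1ℚ - t ≤_) (ℚ.+-identityʳ 1ℚ) (ℚ.+-monoʳ-≤ 1ℚ (ℚ.neg-antimono-≤ 0≤t)) ,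
  trans eq (cong₂ _,_ (lemma a c t) (lemma b d t))
  where
  open +-*-Solver
  lemma : ∀ a c t → a + t * (c - a) ≡ c + (1ℚ - t) * (a - c)
  lemma = solve 3 (λ a c t → a :+ t :* (c :- a) := c :+ (con 1ℚ :- t) :* (a :- c)) refl

start-OnSegment : ∀ p q → OnSegment p q p
start-OnSegment p q = 0ℚ , ℚ.≤-refl , ℚ.<⇒≤ (ℚ.positive⁻¹ 1ℚ) , sym (lerp-0 p q)

-- Along a segment from p to q, a functional that is nonnegative and not
-- identically zero can vanish only in an endpoint.
record Above (g : Functional) (p q : Point) : Set where
  constructor above
  field
    start≥0 : 0ℚ ≤ ⟦ g ⟧ p
    end≥0   : 0ℚ ≤ ⟦ g ⟧ q
    sum>0   : 0ℚ < ⟦ g ⟧ p + ⟦ g ⟧ q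

above? : ∀ g p q → Dec (Above g p q)
above? g p q = map′ (λ (p≥0 , q≥0 , pos) → above p≥0 q≥0 pos)
  (λ (above p≥0 q≥0 pos) → p≥0 , q≥0 , pos)
  (0ℚ ℚ.≤? ⟦ g ⟧ p ×-dec 0ℚ ℚ.≤? ⟦ g ⟧ q ×-dec 0ℚ ℚ.<? ⟦ g ⟧ p + ⟦ g ⟧ q)

Above-swap : ∀ {g p q} → Above g p q → Above g q p
Above-swap {g} {p} {q} (above p≥0 q≥0 pos) =
  above q≥0 p≥0 (subst (0ℚ <_) (ℚ.+-comm (⟦ g ⟧ p) (⟦ g ⟧ q)) pos)

Above-start : ∀ {g p q} → 0ℚ < ⟦ g ⟧ p → 0ℚ ≤ ⟦ g ⟧ q → Above g p q
Above-start p>0 q≥0 = above (ℚ.<⇒≤ p>0) q≥0 (+-pos-nonneg p>0 q≥0)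

Above⇒nonneg : ∀ {g p q x} → Above g p q → OnSegment p q x → 0ℚ ≤ ⟦ g ⟧ x
Above⇒nonneg {g} {p} {q} (above p≥0 q≥0 _) (t , 0≤t , t≤1 , refl) =
  subst (0ℚ ≤_) (sym (⟦⟧-lerp g p q t)) (+-nonneg (*-nonneg (x≤y⇒0≤y-x t≤1) p≥0) (*-nonneg 0≤t q≥0))

-- For `t` strictly between 0 and 1 the value at `x` combines, with positive weights, two
-- nonnegative numbers that are not both zero, so it is positive.
Above-zero : ∀ {g p q x} → Above g p q → OnSegment p q x → ⟦ g ⟧ x ≡ 0ℚ → x ≡ p ⊎ x ≡ q
Above-zero {g} {p} {q} (above p≥0 q≥0 pos) (t , 0≤t , t≤1 , refl) zero-at-x
  with t ℚ.≤? 0ℚ | 1ℚ ℚ.≤? t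
... | yes t≤0 | _ =
  inj₁ (trans (cong (lerp p q) (ℚ.≤-antisym t≤0 0≤t)) (lerp-0 p q))
... | no _ | yes 1≤t =
  inj₂ (trans (cong (lerp p q) (ℚ.≤-antisym t≤1 1≤t)) (lerp-1 p q))
... | no t≰0 | no 1≰t = contradiction strict (ℚ.<-irrefl refl)
  where
  0<t : 0ℚ < t
  0<t = ℚ.≰⇒> t≰0

  balance : (1ℚ - t) * ⟦ g ⟧ p + t * ⟦ g ⟧ q ≡ 0ℚ
  balance = trans (sym (⟦⟧-lerp g p q t)) zero-at-x

  weighted : ∀ {u v} → 0ℚ ≤ u → 0ℚ ≤ v → 0ℚ < u + v → 0ℚ < (1ℚ - t) * u + t * v
  weighted {u} {v} 0≤u 0≤v 0<u+v with u ℚ.≤? 0ℚ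
  ... | no u≰0 = +-pos-nonneg (*-pos (x<y⇒0<y-x (ℚ.≰⇒> 1≰t)) (ℚ.≰⇒> u≰0)) (*-nonneg 0≤t 0≤v)
  ... | yes u≤0 = +-nonneg-pos (*-nonneg (x≤y⇒0≤y-x t≤1) 0≤u) (*-pos 0<t 0<v)
    where
    0<v : 0ℚ < v
    0<v = subst (0ℚ <_) (trans (cong (_+ v) (ℚ.≤-antisym u≤0 0≤u)) (ℚ.+-identityˡ v)) 0<u+v

  strict : 0ℚ < 0ℚ
  strict = subst (0ℚ <_) balance (weighted p≥0 q≥0 pos)

-- Both segments may touch the line where `g` vanishes, as edges with a common end must, but the
-- strict sum in `Above` keeps each of them from lying inside it.
Separated : (p q r s : Point) → Set
Separated p q r s = ∃[ g ] Above g p q × Above (negate g) r s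

Separated-swap : ∀ {p q r s} → Separated p q r s → Separated r s p q
Separated-swap {p} {q} {r} {s} (g , above-pq , above-rs) =
  negate g , above-rs , subst (λ h → Above h p q) (sym (negate-involutive g)) above-pq
  where
  negate-involutive : ∀ g → negate (negate g) ≡ g
  negate-involutive (a , b , c) = cong₂ _,_ (neg-involutive a) (cong₂ _,_ (neg-involutive b) (neg-involutive c))

-- At a common point `g` is both nonnegative and nonpositive, hence zero, and `Above-zero` applies
-- to each segment.
separated⇒disjoint : ∀ {p q r s x} → Separated p q r s → OnSegment p q x → OnSegment r s x →
                     (x ≡ p ⊎ x ≡ q) × (x ≡ r ⊎ x ≡ s)
separated⇒disjoint {p} {q} {r} {s} {x} (g , above-pq , above-rs) on-pq on-rs =
  Above-zero above-pq on-pq zero-at-x ,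
  Above-zero above-rs on-rs (trans (⟦negate⟧ g x) (cong -_ zero-at-x))
  where
  -g[x]≥0 : 0ℚ ≤ - ⟦ g ⟧ x
  -g[x]≥0 = subst (0ℚ ≤_) (⟦negate⟧ g x) (Above⇒nonneg above-rs on-rs)

  g[x]≤0 : ⟦ g ⟧ x ≤ 0ℚ
  g[x]≤0 = subst (_≤ 0ℚ) (neg-involutive _) (ℚ.neg-antimono-≤ -g[x]≥0)

  zero-at-x : ⟦ g ⟧ x ≡ 0ℚ
  zero-at-x = ℚ.≤-antisym g[x]≤0 (Above⇒nonneg above-pq on-pq)

Above-cong : ∀ {g g' p p' q q'} → ⟦ g ⟧ p ≡ ⟦ g' ⟧ p' → ⟦ g ⟧ q ≡ ⟦ g' ⟧ q' →
             Above g p q → Above g' p' q'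
Above-cong p≡ q≡ (above p≥0 q≥0 pos) =
  above (subst (0ℚ ≤_) p≡ p≥0) (subst (0ℚ ≤_) q≡ q≥0) (subst (0ℚ <_) (cong₂ _+_ p≡ q≡) pos)

-- One cell in local coordinates

8ℚ : ℚ
8ℚ = + 8 / 1

-- A spot of a cell has local coordinates (altitude , offset), in which the
-- cell is the triangle with corners top = (8,0), left = (0,0), right = (0,8).
altitude offset : Spot → ℚ
altitude top = 8ℚ
altitude left = 0ℚ
altitude right = 0ℚ
altitude (inner i) = + lookup (2 ∷ 4 ∷ 2 ∷ 4 ∷ 2 ∷ []) i / 1
offset top = 0ℚ
offset left = 0ℚ
offset right = 8ℚ
offset (inner i) = + lookup (3 ∷ 1 ∷ 1 ∷ 3 ∷ 5 ∷ []) i / 1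

local : Spot → Point
local σ = altitude σ , offset σ

altitude-inner>0 : ∀ i → 0ℚ < altitude (inner i)
altitude-inner>0 = from-yes (Fin.all? λ i → 0ℚ ℚ.<? altitude (inner i))

offset-inner>0 : ∀ i → 0ℚ < offset (inner i)
offset-inner>0 = from-yes (Fin.all? λ i → 0ℚ ℚ.<? offset (inner i))

-- `altitude`, `offset` and `slack` add up to 8: up to that factor they are the barycentric
-- coordinates at the top, right and left corner. All three are positive at the inner vertices,
-- which thus lie strictly inside the triangle.
slack : Spot → ℚ
slack σ = (8ℚ - altitude σ) - offset σ

slack-inner>0 : ∀ i → 0ℚ < slack (inner i)
slack-inner>0 = from-yes (Fin.all? λ i → 0ℚ ℚ.<? slack (inner i))

altitude≥0 : ∀ σ → 0ℚ ≤ altitude σ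
altitude≥0 top = from-yes (0ℚ ℚ.≤? 8ℚ)
altitude≥0 left = ℚ.≤-refl
altitude≥0 right = ℚ.≤-refl
altitude≥0 (inner i) = ℚ.<⇒≤ (altitude-inner>0 i)

offset≥0 : ∀ σ → 0ℚ ≤ offset σ
offset≥0 top = ℚ.≤-refl
offset≥0 left = ℚ.≤-refl
offset≥0 right = from-yes (0ℚ ℚ.≤? 8ℚ)
offset≥0 (inner i) = ℚ.<⇒≤ (offset-inner>0 i)

slack≥0 : ∀ σ → 0ℚ ≤ slack σ
slack≥0 top = from-yes (0ℚ ℚ.≤? slack top)
slack≥0 left = from-yes (0ℚ ℚ.≤? slack left)
slack≥0 right = from-yes (0ℚ ℚ.≤? slack right)
slack≥0 (inner i) = ℚ.<⇒≤ (slack-inner>0 i)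

depth≥0 : ∀ σ → 0ℚ ≤ 8ℚ - altitude σ
depth≥0 top = from-yes (0ℚ ℚ.≤? (8ℚ - 8ℚ))
depth≥0 left = from-yes (0ℚ ℚ.≤? (8ℚ - 0ℚ))
depth≥0 right = from-yes (0ℚ ℚ.≤? (8ℚ - 0ℚ))
depth≥0 (inner i) = from-yes (Fin.all? λ i → 0ℚ ℚ.≤? (8ℚ - altitude (inner i))) i

-- Takes the distinct values 9, 13, 7, 15, 11 at the five inner vertices, so one number tells them
-- apart.
separate-inner : Functional
separate-inner = 0ℚ , + 3 / 1 , 1ℚ

local-injective : ∀ i i' →
  ⟦ separate-inner ⟧ (local (inner i)) ≡ ⟦ separate-inner ⟧ (local (inner i')) → i ≡ i'
local-injective = from-yes (Fin.all? λ i → Fin.all? λ i' →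
  (⟦ separate-inner ⟧ (local (inner i)) ℚ.≟ ⟦ separate-inner ⟧ (local (inner i'))) →-dec (i Fin.≟ i'))

-- The two borders through the top corner come first, so bond `e` has index `e` plus 2. With the
-- borders included, one table also separates bonds from the spokes on the border of their cell.
lineStart lineEnd : Fin 16 → Spot
lineStart 0F = top
lineStart 1F = top
lineStart (suc (suc e)) = inner (bondTail e)
lineEnd 0F = left
lineEnd 1F = right
lineEnd (suc (suc e)) = bondHead e

AboveLine : Functional → Fin 16 → Set
AboveLine g e = Above g (local (lineStart e)) (local (lineEnd e))

aboveLine? : ∀ g e → Dec (AboveLine g e)
aboveLine? g e = above? g (local (lineStart e)) (local (lineEnd e))

integral : ℤ × ℤ × ℤ → Functional
integral (a , b , c) = a / 1 , b / 1 , c / 1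

-- Found by a computer search.
separators : List Functional
separators = map integral (
  (+ 8 , ℤ.- + 1 , ℤ.- + 2) ∷ (+ 2 , ℤ.- + 1 , + 0) ∷ (ℤ.- + 1 , ℤ.- + 1 , + 5) ∷ (+ 39 , ℤ.- + 6 , ℤ.- + 5) ∷
  (+ 0 , ℤ.- + 1 , + 3) ∷ (+ 24 , ℤ.- + 4 , ℤ.- + 3) ∷ (+ 1 , ℤ.- + 1 , + 1) ∷ (+ 1 , ℤ.- + 2 , + 1) ∷
  (+ 6 , ℤ.- + 1 , ℤ.- + 2) ∷ (+ 9 , ℤ.- + 3 , ℤ.- + 1) ∷ (+ 8 , ℤ.- + 1 , ℤ.- + 6) ∷ (+ 23 , ℤ.- + 4 , ℤ.- + 3) ∷
  (+ 0 , ℤ.- + 1 , + 1) ∷ (+ 0 , ℤ.- + 1 , + 5) ∷ (+ 8 , ℤ.- + 2 , ℤ.- + 1) ∷ (+ 10 , ℤ.- + 1 , ℤ.- + 2) ∷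
  (+ 32 , ℤ.- + 4 , ℤ.- + 5) ∷ (+ 40 , ℤ.- + 6 , ℤ.- + 5) ∷ [])

opaque
  -- Exchanging `e` and `f` reverses the sign of a separating functional, hence the negated list.
  -- The 256 pairs are checked by evaluation.
  some-separator : ∀ e f → e ≡ f ⊎
    Any (λ g → AboveLine g e × AboveLine (negate g) f) (separators ++ map negate separators)
  some-separator = from-yes (Fin.all? λ e → Fin.all? λ f → (e Fin.≟ f) ⊎-dec
    Any.any? (λ g → aboveLine? g e ×-dec aboveLine? (negate g) f) (separators ++ map negate separators))

lines-separated : ∀ e f → e ≢ f →
  Separated (local (lineStart e)) (local (lineEnd e)) (local (lineStart f)) (local (lineEnd f))
lines-separated e f e≢f with some-separator e f
... | inj₁ e≡f = contradiction e≡f e≢f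
... | inj₂ separator = Any.satisfied separator

-- Placing the cells in the plane

sign : Fin 2 → ℚ
sign 0F = 1ℚ
sign 1F = - 1ℚ

-- The point with local coordinates (α , γ) in the cell of side s whose left corner is (8 κ , 0).
point : ℚ → Fin 2 → Point → Point
point κ s (α , γ) = κ * (8ℚ - α) + γ , sign s * α

height : Fin 2 → Functional
height s = 0ℚ , 0ℚ , sign s

height-point : ∀ s s' κ p → ⟦ height s ⟧ (point κ s' p) ≡ (sign s * sign s') * proj₁ p
height-point s s' κ (α , γ) = solve 4
  (λ e f α x → con 0ℚ :+ (con 0ℚ :* x :+ e :* (f :* α)) := (e :* f) :* α)
  refl (sign s) (sign s') α (κ * (8ℚ - α) + γ)
  where open +-*-Solver

-- Vanishes on the line through (8 κ , 0) and the apex of side s.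
wedge : ℚ → Fin 2 → Functional
wedge κ s = - (8ℚ * κ) , 1ℚ , sign s * κ

-- The value is the signed horizontal distance to the line of `wedge κ s`: at altitude α a cell has
-- width 8 - α, and λ' - κ such widths precede the offset. The sides are separate cases because the
-- identity uses that `sign s` squares to 1.
wedge-point : ∀ κ λ' s p → ⟦ wedge κ s ⟧ (point λ' s p) ≡ proj₂ p + (λ' - κ) * (8ℚ - proj₁ p)
wedge-point κ λ' 0F (α , γ) = solve 4 (λ κ λ' α γ →
  :- (con 8ℚ :* κ) :+ (con 1ℚ :* (λ' :* (con 8ℚ :- α) :+ γ) :+ (con 1ℚ :* κ) :* (con 1ℚ :* α))
  := γ :+ (λ' :- κ) :* (con 8ℚ :- α)) refl κ λ' α γ
  where open +-*-Solver
wedge-point κ λ' 1F (α , γ) = solve 4 (λ κ λ' α γ →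
  :- (con 8ℚ :* κ) :+ (con 1ℚ :* (λ' :* (con 8ℚ :- α) :+ γ) :+ (con (- 1ℚ) :* κ) :* (con (- 1ℚ) :* α))
  := γ :+ (λ' :- κ) :* (con 8ℚ :- α)) refl κ λ' α γ
  where open +-*-Solver

-- Substitutes the inverse of `point κ s`, namely α = `sign s` y and γ = x - κ (8 - α), into the
-- local functional.
globalise : ℚ → Fin 2 → Functional → Functional
globalise κ s (a , b , c) = a - 8ℚ * (c * κ) , c , sign s * (b + c * κ)

globalise-point : ∀ κ s g p → ⟦ globalise κ s g ⟧ (point κ s p) ≡ ⟦ g ⟧ p
globalise-point κ 0F (a , b , c) (α , γ) = solve 6 (λ κ a b c α γ →
  (a :- con 8ℚ :* (c :* κ)) :+ (c :* (κ :* (con 8ℚ :- α) :+ γ) :+ (con 1ℚ :* (b :+ c :* κ)) :* (con 1ℚ :* α))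
  := a :+ (b :* α :+ c :* γ)) refl κ a b c α γ
  where open +-*-Solver
globalise-point κ 1F (a , b , c) (α , γ) = solve 6 (λ κ a b c α γ →
  (a :- con 8ℚ :* (c :* κ)) :+ (c :* (κ :* (con 8ℚ :- α) :+ γ) :+ (con (- 1ℚ) :* (b :+ c :* κ)) :* (con (- 1ℚ) :* α))
  := a :+ (b :* α :+ c :* γ)) refl κ a b c α γ
  where open +-*-Solver

point-separated : ∀ κ s {p q p' q'} → Separated p q p' q' →
                  Separated (point κ s p) (point κ s q) (point κ s p') (point κ s q')
point-separated κ s {p} {q} {p'} {q'} (g , above-pq , above-p'q') =
  globalise κ s g ,
  Above-cong (sym (globalise-point κ s g p)) (sym (globalise-point κ s g q)) above-pq ,
  Above-cong (negated p') (negated q') above-p'q'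
  where
  negated : ∀ r → ⟦ negate g ⟧ r ≡ ⟦ negate (globalise κ s g) ⟧ (point κ s r)
  negated r = trans (⟦negate⟧ g r) (trans (cong -_ (sym (globalise-point κ s g r)))
    (sym (⟦negate⟧ (globalise κ s g) (point κ s r))))

-- Starting at 1 puts all mids to the right of the base edge, which joins the apexes on the vertical
-- line at 0.
abscissa : ℕ → ℚ
abscissa zero = 1ℚ
abscissa (suc m) = abscissa m + 1ℚ

x<x+1 : ∀ x → x < x + 1ℚ
x<x+1 x = subst (_< x + 1ℚ) (ℚ.+-identityʳ x) (ℚ.+-monoʳ-< x (from-yes (0ℚ ℚ.<? 1ℚ)))

abscissa-mono : ∀ {m n} → m ℕ.≤ n → abscissa m ≤ abscissa n
abscissa-mono m≤n = go (ℕ.≤⇒≤′ m≤n)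
  where
  go : ∀ {m n} → m ℕ.≤′ n → abscissa m ≤ abscissa n
  go ℕ.≤′-refl = ℚ.≤-refl
  go (ℕ.≤′-step m≤n) = ℚ.≤-trans (go m≤n) (ℚ.<⇒≤ (x<x+1 _))

abscissa-mono-< : ∀ {m n} → m ℕ.< n → abscissa m < abscissa n
abscissa-mono-< {m} m<n = ℚ.<-≤-trans (x<x+1 (abscissa m)) (abscissa-mono m<n)

½<abscissa : ∀ m → ½ < abscissa m
½<abscissa m = ℚ.<-≤-trans (from-yes (½ ℚ.<? 1ℚ)) (abscissa-mono {zero} {m} z≤n)

sign²≡1 : ∀ s → sign s * sign s ≡ 1ℚ
sign²≡1 0F = refl
sign²≡1 1F = refl

sign*sign≡-1 : ∀ {s s'} → s ≢ s' → sign s * sign s' ≡ - 1ℚ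
sign*sign≡-1 {0F} {0F} s≢s' = contradiction refl s≢s'
sign*sign≡-1 {0F} {1F} _ = refl
sign*sign≡-1 {1F} {0F} _ = refl
sign*sign≡-1 {1F} {1F} s≢s' = contradiction refl s≢s'

height-same : ∀ s κ p → ⟦ height s ⟧ (point κ s p) ≡ proj₁ p
height-same s κ p = trans (height-point s s κ p) (trans (cong (_* proj₁ p) (sign²≡1 s)) (ℚ.*-identityˡ _))

height-other : ∀ {s s'} → s ≢ s' → ∀ κ p → ⟦ negate (height s) ⟧ (point κ s' p) ≡ proj₁ p
height-other {s} {s'} s≢s' κ p = begin
  ⟦ negate (height s) ⟧ (point κ s' p)  ≡⟨ ⟦negate⟧ (height s) (point κ s' p) ⟩
  - ⟦ height s ⟧ (point κ s' p)         ≡⟨ cong -_ (height-point s s' κ p) ⟩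
  - ((sign s * sign s') * proj₁ p)      ≡⟨ cong (λ u → - (u * proj₁ p)) (sign*sign≡-1 s≢s') ⟩
  - (- 1ℚ * proj₁ p)                    ≡⟨ lemma (proj₁ p) ⟩
  proj₁ p                               ∎
  where
  open ≡-Reasoning
  lemma : ∀ α → - (- 1ℚ * α) ≡ α
  lemma = solve 1 (λ α → :- (con (- 1ℚ) :* α) := α) refl
    where open +-*-Solver

-- The negated distance, measured from the right border of the cell: `slack` takes over the part of
-- `offset`, and λ' + 1 that of λ'.
wedge-left : ∀ κ λ' s p →
  ⟦ negate (wedge κ s) ⟧ (point λ' s p) ≡ ((8ℚ - proj₁ p) - proj₂ p) + (κ - (λ' + 1ℚ)) * (8ℚ - proj₁ p)
wedge-left κ λ' s p@(α , γ) =
  trans (⟦negate⟧ (wedge κ s) (point λ' s p)) (trans (cong -_ (wedge-point κ λ' s p)) (lemma κ λ' α γ))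
  where
  open +-*-Solver
  lemma : ∀ κ λ' α γ → - (γ + (λ' - κ) * (8ℚ - α)) ≡ ((8ℚ - α) - γ) + (κ - (λ' + 1ℚ)) * (8ℚ - α)
  lemma = solve 4 (λ κ λ' α γ → :- (γ :+ (λ' :- κ) :* (con 8ℚ :- α))
    := ((con 8ℚ :- α) :- γ) :+ (κ :- (λ' :+ con 1ℚ)) :* (con 8ℚ :- α)) refl

-- The graph on n columns

module Columns (n : ℕ) where

  data V : Set where
    apex : Fin 2 → V
    mid  : Fin (suc n) → V
    cell : Fin n → Fin 2 → Fin 5 → V

  place : Fin n → Fin 2 → Spot → V
  place j s top = apex s
  place j s left = mid (inject₁ j)
  place j s right = mid (suc j)
  place j s (inner i) = cell j s i

  data Arc : Set where
    base  : Arc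
    spoke : Fin 2 → Fin (suc n) → Arc
    bond  : Fin n → Fin 2 → Fin 14 → Arc

  tail head : Arc → V
  tail base = apex 0F
  tail (spoke s k) = apex s
  tail (bond j s e) = cell j s (bondTail e)
  head base = apex 1F
  head (spoke s k) = mid k
  head (bond j s e) = place j s (bondHead e)

  infix 4 _~_
  Joins : Arc → V → V → Set
  Joins a x y = (tail a ≡ x × head a ≡ y) ⊎ (tail a ≡ y × head a ≡ x)

  _~_ : V → V → Set
  x ~ y = ∃[ a ] Joins a x y

  ~-sym : ∀ {x y} → x ~ y → y ~ x
  ~-sym (a , joins) = a , Sum.swap joins

  mid-injective : ∀ {k k'} → mid k ≡ mid k' → k ≡ k'
  mid-injective refl = refl

  place-cell : ∀ {j j' s s' i} σ → place j s σ ≡ cell j' s' i → (j , s) ≡ (j' , s') × σ ≡ inner i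
  place-cell (inner i) refl = refl , refl

  tail≢head : ∀ a → tail a ≢ head a
  tail≢head base ()
  tail≢head (bond j s e) eq = bond-proper e (proj₂ (place-cell (bondHead e) (sym eq)))

  ~-irrefl : ∀ {x} → ¬ x ~ x
  ~-irrefl (a , inj₁ (refl , h≡t)) = tail≢head a (sym h≡t)
  ~-irrefl (a , inj₂ (refl , h≡t)) = tail≢head a (sym h≡t)

  N : ℕ
  N = 2 ℕ.+ (suc n ℕ.+ n ℕ.* (2 ℕ.* 5))

  opaque
    Fin↔V : Fin N ↔ V
    Fin↔V = Sum↔V ↔-∘
      ((↔-id _ ⊎-↔ ((↔-id _ ⊎-↔ ((↔-id _ ×-↔ Fin.*↔×) ↔-∘ Fin.*↔×)) ↔-∘ Fin.+↔⊎ {suc n})) ↔-∘ Fin.+↔⊎ {2})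
      where
      Sum↔V : (Fin 2 ⊎ Fin (suc n) ⊎ Fin n × Fin 2 × Fin 5) ↔ V
      Sum↔V = mk↔ₛ′
        (λ { (inj₁ s) → apex s ; (inj₂ (inj₁ k)) → mid k ; (inj₂ (inj₂ (j , s , i))) → cell j s i })
        (λ { (apex s) → inj₁ s ; (mid k) → inj₂ (inj₁ k) ; (cell j s i) → inj₂ (inj₂ (j , s , i)) })
        (λ { (apex s) → refl ; (mid k) → refl ; (cell j s i) → refl })
        (λ { (inj₁ s) → refl ; (inj₂ (inj₁ k)) → refl ; (inj₂ (inj₂ (j , s , i))) → refl })

  decode : Fin N → V
  decode = Inverse.to Fin↔V

  encode : V → Fin N
  encode = Inverse.from Fin↔V

  decode-encode : ∀ x → decode (encode x) ≡ x
  decode-encode = Inverse.strictlyInverseˡ Fin↔V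

  encode-decode : ∀ i → encode (decode i) ≡ i
  encode-decode = Inverse.strictlyInverseʳ Fin↔V

  encode-injective : ∀ {x y} → encode x ≡ encode y → x ≡ y
  encode-injective {x} {y} eq = trans (sym (decode-encode x)) (trans (cong decode eq) (decode-encode y))

  decode-injective : ∀ {i k} → decode i ≡ decode k → i ≡ k
  decode-injective {i} {k} eq = trans (sym (encode-decode i)) (trans (cong encode eq) (encode-decode k))

  _≟ᵥ_ : DecidableEquality V
  x ≟ᵥ y = map′ encode-injective (cong encode) (encode x Fin.≟ encode y)

  arc : ⊤ ⊎ (Fin 2 × Fin (suc n)) ⊎ (Fin n × Fin 2 × Fin 14) → Arc
  arc (inj₁ tt) = base
  arc (inj₂ (inj₁ (s , k))) = spoke s k
  arc (inj₂ (inj₂ (j , s , e))) = bond j s e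

  unarc : Arc → ⊤ ⊎ (Fin 2 × Fin (suc n)) ⊎ (Fin n × Fin 2 × Fin 14)
  unarc base = inj₁ tt
  unarc (spoke s k) = inj₂ (inj₁ (s , k))
  unarc (bond j s e) = inj₂ (inj₂ (j , s , e))

  arc-unarc : ∀ a → arc (unarc a) ≡ a
  arc-unarc base = refl
  arc-unarc (spoke s k) = refl
  arc-unarc (bond j s e) = refl

  opaque
    _~?_ : ∀ x y → Dec (x ~ y)
    x ~? y = map′ (λ (a , joins) → arc a , joins)
      (λ (a , joins) → unarc a , subst (λ a → Joins a x y) (sym (arc-unarc a)) joins)
      (⊎-searchable ⊤-searchable
        (⊎-searchable (×-searchable Fin-searchable Fin-searchable)
                      (×-searchable Fin-searchable (×-searchable Fin-searchable Fin-searchable)))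
        λ a → (tail (arc a) ≟ᵥ x ×-dec head (arc a) ≟ᵥ y) ⊎-dec (tail (arc a) ≟ᵥ y ×-dec head (arc a) ≟ᵥ x))

  G : Graph
  G = record
    { order = N
    ; Adj = λ i k → decode i ~ decode k
    ; Adj? = λ i k → decode i ~? decode k
    ; sym = ~-sym
    ; irrefl = λ { refl → ~-irrefl }
    }

  encode-adj : ∀ {x y} → x ~ y → Graph.Adj G (encode x) (encode y)
  encode-adj {x} {y} = subst₂ _~_ (sym (decode-encode x)) (sym (decode-encode y))

  cell-neighbour : ∀ {j s i y} → cell j s i ~ y → ∃[ σ ] σ ∈ₗ neighbours i × y ≡ place j s σ
  cell-neighbour (bond j s e , inj₁ (refl , refl)) = bondHead e , bondHead∈neighbours e , refl
  cell-neighbour (bond j s e , inj₂ (refl , eq)) with place-cell (bondHead e) eq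
  ... | refl , head≡ = inner (bondTail e) , bondTail∈neighbours e _ head≡ , refl

  -- The neighbours of a vertex form a list without repetitions inside the explicit one, so the
  -- latter is at least as long.
  degree-cell : ∀ v {j s i} → decode v ≡ cell j s i → Graph.degree G v ℕ.≤ length (neighbours i)
  degree-cell v {j} {s} {i} v≡ = subst (Graph.degree G v ℕ.≤_) (length-map (encode ∘ place j s) (neighbours i))
    (unique-⊆⇒length≤ (filter⁺ (Graph.Adj? G v) (allFin⁺ N)) λ {w} w∈ →
      listed w (proj₂ (∈-filter⁻ (Graph.Adj? G v) {xs = allFin N} w∈)))
    where
    listed : ∀ w → decode v ~ decode w → w ∈ₗ map (encode ∘ place j s) (neighbours i)
    listed w v~w with cell-neighbour (subst (_~ decode w) v≡ v~w)
    ... | σ , σ∈ , w≡ = subst (_∈ₗ _)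
      (trans (cong encode (sym w≡)) (encode-decode w)) (∈-map⁺ (encode ∘ place j s) σ∈)

  neighbour-adj : ∀ {j s i σ} → σ ∈ₗ neighbours i → cell j s i ~ place j s σ
  neighbour-adj {j} {s} {i} {σ} σ∈ = from-bond (neighbour-bond i σ σ∈)
    where
    from-bond : IsBond i σ → cell j s i ~ place j s σ
    from-bond (e , inj₁ (refl , refl)) = bond j s e , inj₁ (refl , refl)
    from-bond (e , inj₂ (refl , eq)) = bond j s e , inj₂ (refl , cong (place j s) eq)

  -- Connectivity

  module Removal (S : Subset N) (∣S∣<3 : ∣ S ∣ ℕ.< 3) where

    Kept : V → Set
    Kept x = encode x ∉ S

    Step : V → V → Set
    Step x y = x ~ y × Kept x × Kept y

    -- Three distinct members would exceed the size of `S`. This selects a surviving route among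
    -- three.
    one-kept : ∀ x y z → x ≢ y → x ≢ z → y ≢ z → Kept x ⊎ Kept y ⊎ Kept z
    one-kept x y z x≢y x≢z y≢z with encode x ∈? S | encode y ∈? S | encode z ∈? S
    ... | no x∉S | _ | _ = inj₁ x∉S
    ... | yes _ | no y∉S | _ = inj₂ (inj₁ y∉S)
    ... | yes _ | yes _ | no z∉S = inj₂ (inj₂ z∉S)
    ... | yes x∈S | yes y∈S | yes z∈S = contradiction
      (unique⇒length≤∣ S ∣
        ((x≢y ∘ encode-injective ∷ x≢z ∘ encode-injective ∷ []) ∷ (y≢z ∘ encode-injective ∷ []) ∷ [] ∷ [])
        (x∈S ∷ y∈S ∷ z∈S ∷ []))
      (ℕ.<⇒≱ ∣S∣<3)

    module Towards
      (r : V)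
      (from-apex : ∀ s → Kept (apex s) → Star Step (apex s) r)
      (from-mid : ∀ k → Kept (mid k) → Star Step (mid k) r)
      where

      module _ (j : Fin n) (s : Fin 2) where

        Safe : Spot → Set
        Safe σ = Kept (place j s σ) → Star Step (place j s σ) r

        via : ∀ {i} σ → σ ∈ₗ neighbours i → Safe σ → Kept (place j s σ) → Safe (inner i)
        via σ σ∈ safe kept kept-i = (neighbour-adj σ∈ , kept-i , kept) ◅ safe kept

        safe-top : Safe top
        safe-top = from-apex s

        safe-left : Safe left
        safe-left = from-mid (inject₁ j)

        safe-right : Safe right
        safe-right = from-mid (suc j)

        left≢right : place j s left ≢ place j s right
        left≢right eq = Fin.<⇒≢ (s≤s (ℕ.≤-reflexive (Fin.toℕ-inject₁ j))) (mid-injective eq)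

        -- If both mids are removed, nothing else is, and the way out leads over `leftTop` to the
        -- apex.
        safe-hub : Safe (inner hub)
        safe-hub with one-kept (place j s left) (place j s right) (place j s top) left≢right (λ ()) (λ ())
        ... | inj₁ k = via left (here refl) safe-left k
        ... | inj₂ (inj₁ k) = via right (there (here refl)) safe-right k
        ... | inj₂ (inj₂ k) with one-kept (place j s left) (place j s right) (cell j s leftTop) left≢right (λ ()) (λ ())
        ...   | inj₁ k′ = via left (here refl) safe-left k′
        ...   | inj₂ (inj₁ k′) = via right (there (here refl)) safe-right k′
        ...   | inj₂ (inj₂ k′) = via (inner leftTop) (there (there (here refl))) (via top (here refl) safe-top k) k′

        -- In the order hub, tops, ins, each vertex after the hub has three neighbours already known
        -- to be safe, and one of them survives.
        safe-inner : ∀ i → Safe (inner i)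
        safe-inner hub = safe-hub
        safe-inner leftTop with one-kept (place j s left) (place j s top) (cell j s hub) (λ ()) (λ ()) (λ ())
        ... | inj₁ k = via left (there (here refl)) safe-left k
        ... | inj₂ (inj₁ k) = via top (here refl) safe-top k
        ... | inj₂ (inj₂ k) = via (inner hub) (there (there (there (here refl)))) safe-hub k
        safe-inner rightTop with one-kept (place j s right) (place j s top) (cell j s hub) (λ ()) (λ ()) (λ ())
        ... | inj₁ k = via right (there (here refl)) safe-right k
        ... | inj₂ (inj₁ k) = via top (here refl) safe-top k
        ... | inj₂ (inj₂ k) = via (inner hub) (there (there (there (here refl)))) safe-hub k
        safe-inner leftIn with one-kept (place j s left) (cell j s leftTop) (cell j s hub) (λ ()) (λ ()) (λ ())
        ... | inj₁ k = via left (here refl) safe-left k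
        ... | inj₂ (inj₁ k) = via (inner leftTop) (there (here refl)) (safe-inner leftTop) k
        ... | inj₂ (inj₂ k) = via (inner hub) (there (there (here refl))) safe-hub k
        safe-inner rightIn with one-kept (place j s right) (cell j s rightTop) (cell j s hub) (λ ()) (λ ()) (λ ())
        ... | inj₁ k = via right (here refl) safe-right k
        ... | inj₂ (inj₁ k) = via (inner rightTop) (there (here refl)) (safe-inner rightTop) k
        ... | inj₂ (inj₂ k) = via (inner hub) (there (there (here refl))) safe-hub k

      reach : ∀ x → Kept x → Star Step x r
      reach (apex s) = from-apex s
      reach (mid k) = from-mid k
      reach (cell j s i) = safe-inner j s i

    apexes-adjacent : ∀ s s' → s ≢ s' → apex s ~ apex s'
    apexes-adjacent 0F 0F s≢s' = contradiction refl s≢s'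
    apexes-adjacent 0F 1F _ = base , inj₁ (refl , refl)
    apexes-adjacent 1F 0F _ = base , inj₂ (refl , refl)
    apexes-adjacent 1F 1F s≢s' = contradiction refl s≢s'

    reach-apex : ∀ s → Kept (apex s) → ∀ x → Kept x → Star Step x (apex s)
    reach-apex s kept = Towards.reach (apex s) from-apex from-mid
      where
      from-apex : ∀ s' → Kept (apex s') → Star Step (apex s') (apex s)
      from-apex s' kept' with s' Fin.≟ s
      ... | yes refl = ε
      ... | no s'≢s = (apexes-adjacent s' s s'≢s , kept' , kept) ◅ ε

      from-mid : ∀ k → Kept (mid k) → Star Step (mid k) (apex s)
      from-mid k kept' = ((spoke s k , inj₂ (refl , refl)) , kept' , kept) ◅ ε

    -- The two apexes exhaust `S`, so everything else survives and consecutive mids are linked by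
    -- the hubs between them.
    reach-mid : ¬ Kept (apex 0F) → ¬ Kept (apex 1F) → ∀ x → Kept x → Star Step x (mid zero)
    reach-mid lost₀ lost₁ = Towards.reach (mid zero) from-apex
      (λ k _ → <-weakInduction (λ k → Star Step (mid k) (mid zero)) ε back k)
      where
      kept : ∀ x → apex 0F ≢ x → apex 1F ≢ x → Kept x
      kept x 0≢x 1≢x = Sum.[ (λ k → contradiction k lost₀) , Sum.[ (λ k → contradiction k lost₁) , id ] ]
        (one-kept (apex 0F) (apex 1F) x (λ ()) 0≢x 1≢x)

      kept-mid : ∀ k → Kept (mid k)
      kept-mid k = kept (mid k) (λ ()) (λ ())

      from-apex : ∀ s → Kept (apex s) → Star Step (apex s) (mid zero)
      from-apex 0F k = contradiction k lost₀
      from-apex 1F k = contradiction k lost₁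

      back : ∀ j → Star Step (mid (inject₁ j)) (mid zero) → Star Step (mid (suc j)) (mid zero)
      back j rest =
        (~-sym (neighbour-adj {σ = right} (there (here refl))) , kept-mid (suc j) , kept-hub) ◅
        (neighbour-adj {σ = left} (here refl) , kept-hub , kept-mid (inject₁ j)) ◅ rest
        where
        kept-hub : Kept (cell j 0F hub)
        kept-hub = kept (cell j 0F hub) (λ ()) (λ ())

    reach-some : ∃[ r ] ∀ x → Kept x → Star Step x r
    reach-some with encode (apex 0F) ∈? S | encode (apex 1F) ∈? S
    ... | no kept | _ = apex 0F , reach-apex 0F kept
    ... | yes _ | no kept = apex 1F , reach-apex 1F kept
    ... | yes lost₀ | yes lost₁ = mid zero , reach-mid (λ k → k lost₀) (λ k → k lost₁)

    connected : ConnectedOutside G S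
    connected {u} {v} u∉S v∉S = subst₂ (Star _) (encode-decode u) (encode-decode v)
      (Star.gmap encode (λ (x~y , x∉S , y∉S) → encode-adj x~y , x∉S , y∉S)
        (to-r (decode u) (kept u u∉S) ◅◅
         Star.reverse (λ (x~y , x∉S , y∉S) → ~-sym x~y , y∉S , x∉S) (to-r (decode v) (kept v v∉S))))
      where
      to-r = proj₂ reach-some
      kept : ∀ w → w ∉ S → Kept (decode w)
      kept w = subst (_∉ S) (sym (encode-decode w))

  3-connected : 0 ℕ.< n → 3 -Connected G
  3-connected 0<n = s≤s (s≤s (s≤s (ℕ.≤-trans 0<n (ℕ.m≤m+n n _)))) , Removal.connected

  -- The drawing

  opaque
    pos : V → Point
    pos (apex s) = point 0ℚ s (local top)
    pos (mid k) = point (abscissa (toℕ k)) 0F (local left)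
    pos (cell j s i) = point (abscissa (toℕ j)) s (local (inner i))

    pos-apex : ∀ κ s → pos (apex s) ≡ point κ s (local top)
    pos-apex κ s = cong (_, sign s * 8ℚ) (lemma κ)
      where
      open +-*-Solver
      lemma : ∀ κ → 0ℚ * (8ℚ - 8ℚ) + 0ℚ ≡ κ * (8ℚ - 8ℚ) + 0ℚ
      lemma = solve 1 (λ κ → con 0ℚ :* (con 8ℚ :- con 8ℚ) :+ con 0ℚ := κ :* (con 8ℚ :- con 8ℚ) :+ con 0ℚ) refl

    pos-mid : ∀ k s → pos (mid k) ≡ point (abscissa (toℕ k)) s (local left)
    pos-mid k 0F = refl
    pos-mid k 1F = refl

    -- Corners shared by several cells get one point: at the top the coefficient of κ is 8 - 8, on
    -- the axis the sign multiplies 0, and the right corner for κ is the left corner for κ + 1.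
    -- Hence local computations hold in the drawing.
    pos-place : ∀ j s σ → pos (place j s σ) ≡ point (abscissa (toℕ j)) s (local σ)
    pos-place j s top = pos-apex (abscissa (toℕ j)) s
    pos-place j s left = trans (pos-mid (inject₁ j) s)
      (cong (λ m → point (abscissa m) s (local left)) (Fin.toℕ-inject₁ j))
    pos-place j s right = cong₂ _,_ (lemma (abscissa (toℕ j)))
      (trans (ℚ.*-zeroʳ (sign 0F)) (sym (ℚ.*-zeroʳ (sign s))))
      where
      open +-*-Solver
      lemma : ∀ κ → (κ + 1ℚ) * (8ℚ - 0ℚ) + 0ℚ ≡ κ * (8ℚ - 0ℚ) + 8ℚ
      lemma = solve 1 (λ κ → (κ :+ con 1ℚ) :* (con 8ℚ :- con 0ℚ) :+ con 0ℚ := κ :* (con 8ℚ :- con 0ℚ) :+ con 8ℚ) refl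
    pos-place j s (inner i) = refl

  infix 4 _lies-above_
  _lies-above_ : Arc → Functional → Set
  a lies-above g = Above g (pos (tail a)) (pos (head a))

  record Apart (a b : Arc) : Set where
    constructor apart
    field
      separated : Separated (pos (tail a)) (pos (head a)) (pos (tail b)) (pos (head b))

  Apart-swap : ∀ {a b} → Apart a b → Apart b a
  Apart-swap (apart separated) = apart (Separated-swap separated)

  start-above : ∀ a g {u v} → ⟦ g ⟧ (pos (tail a)) ≡ u → ⟦ g ⟧ (pos (head a)) ≡ v →
                0ℚ < u → 0ℚ ≤ v → a lies-above g
  start-above a g u≡ v≡ 0<u 0≤v =
    Above-start (subst (0ℚ <_) (sym u≡) 0<u) (subst (0ℚ ≤_) (sym v≡) 0≤v)

  end-above : ∀ a g {u v} → ⟦ g ⟧ (pos (tail a)) ≡ u → ⟦ g ⟧ (pos (head a)) ≡ v →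
              0ℚ ≤ u → 0ℚ < v → a lies-above g
  end-above a g u≡ v≡ 0≤u 0<v =
    Above-swap (Above-start (subst (0ℚ <_) (sym v≡) 0<v) (subst (0ℚ ≤_) (sym u≡) 0≤u))

  0<8 : 0ℚ < 8ℚ
  0<8 = from-yes (0ℚ ℚ.<? 8ℚ)

  at-apex : ∀ g s κ {u} → ⟦ g ⟧ (point κ s (local top)) ≡ u → ⟦ g ⟧ (pos (apex s)) ≡ u
  at-apex g s κ = trans (cong ⟦ g ⟧ (pos-apex κ s))

  at-mid : ∀ g s k {u} → ⟦ g ⟧ (point (abscissa (toℕ k)) s (local left)) ≡ u → ⟦ g ⟧ (pos (mid k)) ≡ u
  at-mid g s k = trans (cong ⟦ g ⟧ (pos-mid k s))

  at-place : ∀ g j s σ {u} → ⟦ g ⟧ (point (abscissa (toℕ j)) s (local σ)) ≡ u → ⟦ g ⟧ (pos (place j s σ)) ≡ u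
  at-place g j s σ = trans (cong ⟦ g ⟧ (pos-place j s σ))

  height-apex : ∀ s → ⟦ height s ⟧ (pos (apex s)) ≡ 8ℚ
  height-apex s = at-apex (height s) s 0ℚ (height-same s 0ℚ (local top))

  height-mid : ∀ s k → ⟦ height s ⟧ (pos (mid k)) ≡ 0ℚ
  height-mid s k = at-mid (height s) s k (height-same s (abscissa (toℕ k)) (local left))

  height-place : ∀ j s σ → ⟦ height s ⟧ (pos (place j s σ)) ≡ altitude σ
  height-place j s σ = at-place (height s) j s σ (height-same s (abscissa (toℕ j)) (local σ))

  negate-height-apex : ∀ {s s'} → s ≢ s' → ⟦ negate (height s) ⟧ (pos (apex s')) ≡ 8ℚ
  negate-height-apex {s} {s'} s≢s' =
    at-apex (negate (height s)) s' 0ℚ (height-other s≢s' 0ℚ (local top))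

  negate-height-mid : ∀ s k → ⟦ negate (height s) ⟧ (pos (mid k)) ≡ 0ℚ
  negate-height-mid s k = trans (⟦negate⟧ (height s) (pos (mid k))) (cong -_ (height-mid s k))

  negate-height-place : ∀ {s s'} → s ≢ s' → ∀ j σ →
                        ⟦ negate (height s) ⟧ (pos (place j s' σ)) ≡ altitude σ
  negate-height-place {s} {s'} s≢s' j σ =
    at-place (negate (height s)) j s' σ (height-other s≢s' (abscissa (toℕ j)) (local σ))

  wedge-place : ∀ κ j s σ → ⟦ wedge κ s ⟧ (pos (place j s σ)) ≡
                offset σ + (abscissa (toℕ j) - κ) * (8ℚ - altitude σ)
  wedge-place κ j s σ = at-place (wedge κ s) j s σ (wedge-point κ (abscissa (toℕ j)) s (local σ))

  negate-wedge-place : ∀ κ j s σ → ⟦ negate (wedge κ s) ⟧ (pos (place j s σ)) ≡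
                       slack σ + (κ - abscissa (suc (toℕ j))) * (8ℚ - altitude σ)
  negate-wedge-place κ j s σ =
    at-place (negate (wedge κ s)) j s σ (wedge-left κ (abscissa (toℕ j)) s (local σ))

  spoke-above-height : ∀ s k → spoke s k lies-above height s
  spoke-above-height s k =
    start-above (spoke s k) (height s) (height-apex s) (height-mid s k) 0<8 ℚ.≤-refl

  spoke-below-height : ∀ {s s'} → s ≢ s' → ∀ k → spoke s' k lies-above negate (height s)
  spoke-below-height {s} {s'} s≢s' k =
    start-above (spoke s' k) (negate (height s)) (negate-height-apex s≢s') (negate-height-mid s k) 0<8 ℚ.≤-refl

  -- The tail of a bond is an inner vertex, where altitude, offset and slack are positive. This
  -- gives the strict part of `Above` here and in the other bond lemmas; the head may lie on the
  -- line.
  bond-above-height : ∀ j s e → bond j s e lies-above height s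
  bond-above-height j s e = start-above (bond j s e) (height s)
    (height-place j s (inner (bondTail e))) (height-place j s (bondHead e))
    (altitude-inner>0 (bondTail e)) (altitude≥0 (bondHead e))

  bond-below-height : ∀ {s s'} → s ≢ s' → ∀ j e → bond j s' e lies-above negate (height s)
  bond-below-height {s} {s'} s≢s' j e = start-above (bond j s' e) (negate (height s))
    (negate-height-place s≢s' j (inner (bondTail e))) (negate-height-place s≢s' j (bondHead e))
    (altitude-inner>0 (bondTail e)) (altitude≥0 (bondHead e))

  right-of-wedge : ∀ κ (j : Fin n) σ → κ ≤ abscissa (toℕ j) →
                   0ℚ ≤ (abscissa (toℕ j) - κ) * (8ℚ - altitude σ)
  right-of-wedge κ j σ κ≤ = *-nonneg (x≤y⇒0≤y-x κ≤) (depth≥0 σ)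

  left-of-wedge : ∀ κ (j : Fin n) σ → abscissa (suc (toℕ j)) ≤ κ →
                  0ℚ ≤ (κ - abscissa (suc (toℕ j))) * (8ℚ - altitude σ)
  left-of-wedge κ j σ ≤κ = *-nonneg (x≤y⇒0≤y-x ≤κ) (depth≥0 σ)

  bond-right-of : ∀ κ j s e → κ ≤ abscissa (toℕ j) → bond j s e lies-above wedge κ s
  bond-right-of κ j s e κ≤ = start-above (bond j s e) (wedge κ s)
    (wedge-place κ j s (inner (bondTail e))) (wedge-place κ j s (bondHead e))
    (+-pos-nonneg (offset-inner>0 (bondTail e)) (right-of-wedge κ j (inner (bondTail e)) κ≤))
    (+-nonneg (offset≥0 (bondHead e)) (right-of-wedge κ j (bondHead e) κ≤))

  bond-left-of : ∀ κ j s e → abscissa (suc (toℕ j)) ≤ κ → bond j s e lies-above negate (wedge κ s)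
  bond-left-of κ j s e ≤κ = start-above (bond j s e) (negate (wedge κ s))
    (negate-wedge-place κ j s (inner (bondTail e))) (negate-wedge-place κ j s (bondHead e))
    (+-pos-nonneg (slack-inner>0 (bondTail e)) (left-of-wedge κ j (inner (bondTail e)) ≤κ))
    (+-nonneg (slack≥0 (bondHead e)) (left-of-wedge κ j (bondHead e) ≤κ))

  cell>wedge : ∀ κ j s i → κ ≤ abscissa (toℕ j) → 0ℚ < ⟦ wedge κ s ⟧ (pos (cell j s i))
  cell>wedge κ j s i κ≤ = subst (0ℚ <_) (sym (wedge-place κ j s (inner i)))
    (+-pos-nonneg (offset-inner>0 i) (right-of-wedge κ j (inner i) κ≤))

  cell>height : ∀ j s i → 0ℚ < ⟦ height s ⟧ (pos (cell j s i))
  cell>height j s i = subst (0ℚ <_) (sym (height-place j s (inner i))) (altitude-inner>0 i)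

  wedge-apex : ∀ κ s → ⟦ wedge κ s ⟧ (pos (apex s)) ≡ 0ℚ
  wedge-apex κ s = at-apex (wedge κ s) s 0ℚ (trans (wedge-point κ 0ℚ s (local top)) (lemma κ))
    where
    open +-*-Solver
    lemma : ∀ κ → 0ℚ + (0ℚ - κ) * (8ℚ - 8ℚ) ≡ 0ℚ
    lemma = solve 1 (λ κ → con 0ℚ :+ (con 0ℚ :- κ) :* (con 8ℚ :- con 8ℚ) := con 0ℚ) refl

  negate-wedge-apex : ∀ κ s → ⟦ negate (wedge κ s) ⟧ (pos (apex s)) ≡ 0ℚ
  negate-wedge-apex κ s = trans (⟦negate⟧ (wedge κ s) (pos (apex s))) (cong -_ (wedge-apex κ s))

  wedge-mid : ∀ κ s k → ⟦ wedge κ s ⟧ (pos (mid k)) ≡ (abscissa (toℕ k) - κ) * 8ℚ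
  wedge-mid κ s k = at-mid (wedge κ s) s k (trans (wedge-point κ (abscissa (toℕ k)) s (local left)) (ℚ.+-identityˡ _))

  negate-wedge-mid : ∀ κ s k → ⟦ negate (wedge κ s) ⟧ (pos (mid k)) ≡ (κ - abscissa (toℕ k)) * 8ℚ
  negate-wedge-mid κ s k = trans (⟦negate⟧ (wedge κ s) (pos (mid k)))
    (trans (cong -_ (wedge-mid κ s k)) (lemma _ κ))
    where
    open +-*-Solver
    lemma : ∀ x κ → - ((x - κ) * 8ℚ) ≡ (κ - x) * 8ℚ
    lemma = solve 2 (λ x κ → :- ((x :- κ) :* con 8ℚ) := (κ :- x) :* con 8ℚ) refl

  -- The apex lies on the line itself, so strictness has to come from the mid.
  spoke-right-of : ∀ κ s k → κ < abscissa (toℕ k) → spoke s k lies-above wedge κ s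
  spoke-right-of κ s k κ< =
    end-above (spoke s k) (wedge κ s) (wedge-apex κ s) (wedge-mid κ s k) ℚ.≤-refl (*-pos (x<y⇒0<y-x κ<) 0<8)

  spoke-left-of : ∀ κ s k → abscissa (toℕ k) < κ → spoke s k lies-above negate (wedge κ s)
  spoke-left-of κ s k <κ = end-above (spoke s k) (negate (wedge κ s))
    (negate-wedge-apex κ s) (negate-wedge-mid κ s k) ℚ.≤-refl (*-pos (x<y⇒0<y-x <κ) 0<8)

  opaque
    unfolding pos

    -- ½ lies between 0, where the base is, and 1, the abscissa of the first mid. The line meets the
    -- base in the apex `s` only.
    base-left-of-½ : ∀ s → base lies-above negate (wedge ½ s)
    base-left-of-½ 0F = from-yes (above? (negate (wedge ½ 0F)) (pos (apex 0F)) (pos (apex 1F)))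
    base-left-of-½ 1F = from-yes (above? (negate (wedge ½ 1F)) (pos (apex 0F)) (pos (apex 1F)))

  by-height : ∀ s a b → a lies-above height s → b lies-above negate (height s) → Apart a b
  by-height s a b above-a above-b = apart (height s , above-a , above-b)

  by-wedge : ∀ κ s a b → a lies-above negate (wedge κ s) → b lies-above wedge κ s → Apart a b
  by-wedge κ s a b above-a above-b = apart (Separated-swap (wedge κ s , above-b , above-a))

  cellLine : Fin n → Fin 2 → Fin 16 → Arc
  cellLine j s 0F = spoke s (inject₁ j)
  cellLine j s 1F = spoke s (suc j)
  cellLine j s (suc (suc e)) = bond j s e

  lines-apart : ∀ j s e f → e ≢ f → Apart (cellLine j s e) (cellLine j s f)
  lines-apart j s e f e≢f = apart (subst₂ (λ (p , q) (p' , q') → Separated p q p' q') (ends≡ e) (ends≡ f)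
    (point-separated (abscissa (toℕ j)) s (lines-separated e f e≢f)))
    where
    spot : Spot → Point
    spot σ = point (abscissa (toℕ j)) s (local σ)

    ends≡ : ∀ e → (spot (lineStart e) , spot (lineEnd e)) ≡
                  (pos (tail (cellLine j s e)) , pos (head (cellLine j s e)))
    ends≡ 0F = cong₂ _,_ (sym (pos-place j s top)) (sym (pos-place j s left))
    ends≡ 1F = cong₂ _,_ (sym (pos-place j s top)) (sym (pos-place j s right))
    ends≡ (suc (suc e)) = cong₂ _,_
      (sym (pos-place j s (inner (bondTail e)))) (sym (pos-place j s (bondHead e)))

  -- A spoke away from the cell is separated from it by one of the two border lines; a spoke on a
  -- border is one of the first two lines of the local table.
  spoke-bond-apart-same-side : ∀ s k j e → Apart (spoke s k) (bond j s e)
  spoke-bond-apart-same-side s k j e with ℕ.<-cmp (toℕ k) (toℕ j)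
  ... | tri< k<j _ _ = by-wedge κ s (spoke s k) (bond j s e)
    (spoke-left-of κ s k (abscissa-mono-< {toℕ k} {toℕ j} k<j)) (bond-right-of κ j s e ℚ.≤-refl)
    where κ = abscissa (toℕ j)
  ... | tri≈ _ k≡j _ = subst (λ k → Apart (spoke s k) (bond j s e))
    (Fin.toℕ-injective (trans (Fin.toℕ-inject₁ j) (sym k≡j))) (lines-apart j s 0F (suc (suc e)) λ ())
  ... | tri> _ _ k>j with ℕ.m≤n⇒m<n∨m≡n k>j
  ...   | inj₁ k>1+j = Apart-swap (by-wedge κ s (bond j s e) (spoke s k)
    (bond-left-of κ j s e ℚ.≤-refl) (spoke-right-of κ s k (abscissa-mono-< {suc (toℕ j)} {toℕ k} k>1+j)))
    where κ = abscissa (suc (toℕ j))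
  ...   | inj₂ k≡1+j = subst (λ k → Apart (spoke s k) (bond j s e))
    (Fin.toℕ-injective k≡1+j) (lines-apart j s 1F (suc (suc e)) λ ())

  spoke-left-of-spoke : ∀ s {k k'} → toℕ k ℕ.< toℕ k' → Apart (spoke s k) (spoke s k')
  -- Each spoke lies inside the line given by its own abscissa, so the separating line must pass
  -- strictly between them.
  spoke-left-of-spoke s {k} {k'} k<k' with ℚ.<-dense (abscissa-mono-< {toℕ k} {toℕ k'} k<k')
  ... | κ , k<κ , κ<k' =
    by-wedge κ s (spoke s k) (spoke s k') (spoke-left-of κ s k k<κ) (spoke-right-of κ s k' κ<k')

  bond-left-of-bond : ∀ s {j j'} e e' → toℕ j ℕ.< toℕ j' → Apart (bond j s e) (bond j' s e')
  bond-left-of-bond s {j} {j'} e e' j<j' =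
    by-wedge κ s (bond j s e) (bond j' s e') (bond-left-of κ j s e (abscissa-mono {suc (toℕ j)} {toℕ j'} j<j'))
      (bond-right-of κ j' s e' ℚ.≤-refl)
    where κ = abscissa (toℕ j')

  spokes-apart : ∀ s s' k k' → spoke s k ≢ spoke s' k' → Apart (spoke s k) (spoke s' k')
  spokes-apart s s' k k' a≢b with s Fin.≟ s'
  ... | no s≢s' =
    by-height s (spoke s k) (spoke s' k') (spoke-above-height s k) (spoke-below-height s≢s' k')
  ... | yes refl with ℕ.<-cmp (toℕ k) (toℕ k')
  ...   | tri< k<k' _ _ = spoke-left-of-spoke s k<k'
  ...   | tri≈ _ k≡k' _ = contradiction (cong (spoke s) (Fin.toℕ-injective k≡k')) a≢b
  ...   | tri> _ _ k>k' = Apart-swap (spoke-left-of-spoke s k>k')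

  spoke-bond-apart : ∀ s k j s' e → Apart (spoke s k) (bond j s' e)
  spoke-bond-apart s k j s' e with s Fin.≟ s'
  ... | yes refl = spoke-bond-apart-same-side s k j e
  ... | no s≢s' = by-height s (spoke s k) (bond j s' e) (spoke-above-height s k) (bond-below-height s≢s' j e)

  bonds-apart : ∀ j s e j' s' e' → bond j s e ≢ bond j' s' e' → Apart (bond j s e) (bond j' s' e')
  bonds-apart j s e j' s' e' a≢b with s Fin.≟ s'
  ... | no s≢s' =
    by-height s (bond j s e) (bond j' s' e') (bond-above-height j s e) (bond-below-height s≢s' j' e')
  ... | yes refl with ℕ.<-cmp (toℕ j) (toℕ j')
  ...   | tri< j<j' _ _ = bond-left-of-bond s e e' j<j'
  ...   | tri> _ _ j>j' = Apart-swap (bond-left-of-bond s e' e j>j')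
  ...   | tri≈ _ j≡j' _ with Fin.toℕ-injective j≡j'
  ...     | refl = lines-apart j s (suc (suc e)) (suc (suc e')) λ { refl → a≢b refl }

  arcs-apart : ∀ a b → a ≢ b → Apart a b
  arcs-apart base base a≢b = contradiction refl a≢b
  arcs-apart base (spoke s k) _ =
    by-wedge ½ s base (spoke s k) (base-left-of-½ s) (spoke-right-of ½ s k (½<abscissa (toℕ k)))
  arcs-apart base (bond j s e) _ =
    by-wedge ½ s base (bond j s e) (base-left-of-½ s) (bond-right-of ½ j s e (ℚ.<⇒≤ (½<abscissa (toℕ j))))
  arcs-apart (spoke s k) base _ = Apart-swap (arcs-apart base (spoke s k) λ ())
  arcs-apart (spoke s k) (spoke s' k') a≢b = spokes-apart s s' k k' a≢b
  arcs-apart (spoke s k) (bond j s' e) _ = spoke-bond-apart s k j s' e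
  arcs-apart (bond j s e) base _ = Apart-swap (arcs-apart base (bond j s e) λ ())
  arcs-apart (bond j s e) (spoke s' k) _ = Apart-swap (spoke-bond-apart s' k j s e)
  arcs-apart (bond j s e) (bond j' s' e') a≢b = bonds-apart j s e j' s' e' a≢b

  -- Injectivity of the vertex positions

  distinguish : ∀ g {p q} → 0ℚ < ⟦ g ⟧ p → 0ℚ ≤ ⟦ negate g ⟧ q → p ≢ q
  distinguish g {p} g>0 -g≥0 refl = ℚ.<-irrefl (sym (ℚ.+-inverseʳ (⟦ g ⟧ p)))
    (+-pos-nonneg g>0 (subst (0ℚ ≤_) (⟦negate⟧ g p) -g≥0))

  apex≢apex : ∀ {s s'} → s ≢ s' → pos (apex s) ≢ pos (apex s')
  apex≢apex {s} {s'} s≢s' = distinguish (height s)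
    (subst (0ℚ <_) (sym (height-apex s)) 0<8)
    (subst (0ℚ ≤_) (sym (negate-height-apex s≢s')) (ℚ.<⇒≤ 0<8))

  mid≢apex : ∀ k s → pos (mid k) ≢ pos (apex s)
  mid≢apex k s = distinguish (wedge ½ s)
    (subst (0ℚ <_) (sym (wedge-mid ½ s k)) (*-pos (x<y⇒0<y-x (½<abscissa (toℕ k))) 0<8))
    (ℚ.≤-reflexive (sym (negate-wedge-apex ½ s)))

  cell≢apex : ∀ j s i s' → pos (cell j s i) ≢ pos (apex s')
  cell≢apex j s i s' with s Fin.≟ s'
  ... | no s≢s' = distinguish (height s)
    (cell>height j s i)
    (subst (0ℚ ≤_) (sym (negate-height-apex s≢s')) (ℚ.<⇒≤ 0<8))
  ... | yes refl = distinguish (wedge ½ s) (cell>wedge ½ j s i (ℚ.<⇒≤ (½<abscissa (toℕ j))))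
    (ℚ.≤-reflexive (sym (negate-wedge-apex ½ s)))

  mid≢mid : ∀ {k k'} → toℕ k ℕ.< toℕ k' → pos (mid k') ≢ pos (mid k)
  mid≢mid {k} {k'} k<k' = distinguish (wedge κ 0F)
    (subst (0ℚ <_) (sym (wedge-mid κ 0F k')) (*-pos (x<y⇒0<y-x (abscissa-mono-< {toℕ k} {toℕ k'} k<k')) 0<8))
    (subst (0ℚ ≤_) (sym (negate-wedge-mid κ 0F k)) (*-nonneg (x≤y⇒0≤y-x (ℚ.≤-refl {κ})) (ℚ.<⇒≤ 0<8)))
    where κ = abscissa (toℕ k)

  cell≢mid : ∀ j s i k → pos (cell j s i) ≢ pos (mid k)
  cell≢mid j s i k = distinguish (height s)
    (cell>height j s i)
    (ℚ.≤-reflexive (sym (negate-height-mid s k)))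

  cell≢cell : ∀ {j j'} s i i' → toℕ j ℕ.< toℕ j' → pos (cell j' s i') ≢ pos (cell j s i)
  cell≢cell {j} {j'} s i i' j<j' = distinguish (wedge κ s) (cell>wedge κ j' s i' ℚ.≤-refl)
    (subst (0ℚ ≤_) (sym (negate-wedge-place κ j s (inner i)))
      (+-nonneg (slack≥0 (inner i)) (left-of-wedge κ j (inner i) (abscissa-mono {suc (toℕ j)} {toℕ j'} j<j'))))
    where κ = abscissa (toℕ j')

  cells-injective : ∀ j s i j' s' i' → pos (cell j s i) ≡ pos (cell j' s' i') → cell j s i ≡ cell j' s' i'
  cells-injective j s i j' s' i' eq with s Fin.≟ s'
  ... | no s≢s' = contradiction eq (distinguish (height s)
    (cell>height j s i)
    (subst (0ℚ ≤_) (sym (negate-height-place s≢s' j' (inner i'))) (altitude≥0 (inner i'))))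
  ... | yes refl with ℕ.<-cmp (toℕ j) (toℕ j')
  ...   | tri< j<j' _ _ = contradiction (sym eq) (cell≢cell s i i' j<j')
  ...   | tri> _ _ j>j' = contradiction eq (cell≢cell s i' i j>j')
  ...   | tri≈ _ j≡j' _ with Fin.toℕ-injective j≡j'
  -- Within one cell, `separate-inner` carried over to the plane identifies the inner vertex.
  ...     | refl = cong (cell j s) (local-injective i i' (trans (sym (code i)) (trans (cong ⟦ g ⟧ eq) (code i'))))
    where
    g = globalise (abscissa (toℕ j)) s separate-inner
    code : ∀ i → ⟦ g ⟧ (pos (cell j s i)) ≡ ⟦ separate-inner ⟧ (local (inner i))
    code i = at-place g j s (inner i) (globalise-point (abscissa (toℕ j)) s separate-inner (local (inner i)))

  pos-injective : ∀ x y → pos x ≡ pos y → x ≡ y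
  pos-injective (apex s) (apex s') eq = cong apex (decidable-stable (s Fin.≟ s') λ s≢s' → apex≢apex s≢s' eq)
  pos-injective (apex s) (mid k) eq = contradiction (sym eq) (mid≢apex k s)
  pos-injective (apex s) (cell j s' i) eq = contradiction (sym eq) (cell≢apex j s' i s)
  pos-injective (mid k) (apex s) eq = contradiction eq (mid≢apex k s)
  pos-injective (mid k) (mid k') eq with ℕ.<-cmp (toℕ k) (toℕ k')
  ... | tri< k<k' _ _ = contradiction (sym eq) (mid≢mid k<k')
  ... | tri≈ _ k≡k' _ = cong mid (Fin.toℕ-injective k≡k')
  ... | tri> _ _ k>k' = contradiction eq (mid≢mid k>k')
  pos-injective (mid k) (cell j s i) eq = contradiction (sym eq) (cell≢mid j s i k)
  pos-injective (cell j s i) (apex s') eq = contradiction eq (cell≢apex j s i s')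
  pos-injective (cell j s i) (mid k) eq = contradiction eq (cell≢mid j s i k)
  pos-injective (cell j s i) (cell j' s' i') eq = cells-injective j s i j' s' i' eq

  -- From arcs to the edges of the drawing

  D : Drawing G
  D = record { position = pos ∘ decode ; bends = λ _ → [] }

  open Drawing D

  -- An edge lists the smaller vertex first while an arc has its own orientation, so an edge may
  -- follow its arc in either direction.
  Runs : Arc → Graph.Edge G → Set
  Runs a e = Joins a (decode (proj₁ (Graph.ends G e))) (decode (proj₂ (Graph.ends G e)))

  On-arc : ∀ {a} e {x} → Runs a e → On e x → OnSegment (pos (tail a)) (pos (head a)) x
  On-arc {a} e {x} (inj₁ (t≡ , h≡)) = subst₂ (λ u v → OnSegment (pos u) (pos v) x) (sym t≡) (sym h≡)
  On-arc {a} e {x} (inj₂ (t≡ , h≡)) on = subst₂ (λ u v → OnSegment (pos u) (pos v) x) (sym t≡) (sym h≡)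
    (OnSegment-sym {source e} {target e} on)

  EndOf-arc : ∀ {a} e {x} → Runs a e → x ≡ pos (tail a) ⊎ x ≡ pos (head a) → EndOf e x
  EndOf-arc e (inj₁ (t≡ , h≡)) = Sum.map (λ eq → trans eq (cong pos t≡)) (λ eq → trans eq (cong pos h≡))
  EndOf-arc e (inj₂ (t≡ , h≡)) = Sum.swap ∘ Sum.map (λ eq → trans eq (cong pos t≡)) (λ eq → trans eq (cong pos h≡))

  -- The ends agree as unordered pairs; opposite orientations would contradict that both edges put
  -- the smaller end first.
  same-arc : ∀ {a} e f → Runs a e → Runs a f → Graph.ends G e ≡ Graph.ends G f
  same-arc ((u , v) , _) ((u' , v') , _) (inj₁ (p , q)) (inj₁ (p' , q')) =
    cong₂ _,_ (decode-injective (trans (sym p) p')) (decode-injective (trans (sym q) q'))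
  same-arc ((u , v) , _) ((u' , v') , _) (inj₂ (p , q)) (inj₂ (p' , q')) =
    cong₂ _,_ (decode-injective (trans (sym q) q')) (decode-injective (trans (sym p) p'))
  same-arc ((u , v) , u<v , _) ((u' , v') , u'<v' , _) (inj₁ (p , q)) (inj₂ (p' , q'))
    with decode-injective (trans (sym p) p') | decode-injective (trans (sym q) q')
  ... | refl | refl = contradiction u'<v' (ℕ.<-asym u<v)
  same-arc ((u , v) , u<v , _) ((u' , v') , u'<v' , _) (inj₂ (p , q)) (inj₁ (p' , q'))
    with decode-injective (trans (sym p) p') | decode-injective (trans (sym q) q')
  ... | refl | refl = contradiction u'<v' (ℕ.<-asym u<v)

  no-crossings : ∀ e f → Graph.ends G e ≢ Graph.ends G f → ∀ x → On e x → On f x → EndOf e x × EndOf f x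
  no-crossings e@(_ , _ , a , runs-a) f@(_ , _ , b , runs-b) e≢f x on-e on-f =
    let end-a , end-b = separated⇒disjoint (Apart.separated (arcs-apart a b a≢b))
                        (On-arc e runs-a on-e) (On-arc f runs-b on-f)
    in EndOf-arc e runs-a end-a , EndOf-arc f runs-b end-b
    where
    a≢b : a ≢ b
    a≢b refl = e≢f (same-arc e f runs-a runs-b)

  some-neighbour : ∀ x → ∃[ y ] x ~ y
  some-neighbour (apex 0F) = apex 1F , base , inj₁ (refl , refl)
  some-neighbour (apex 1F) = apex 0F , base , inj₂ (refl , refl)
  some-neighbour (mid k) = apex 0F , spoke 0F k , inj₂ (refl , refl)
  some-neighbour (cell j s i) = place j s _ , neighbour-adj (first∈neighbours i)
    where
    first : Fin 5 → Spot
    first hub = left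
    first leftTop = left
    first leftIn = left
    first rightTop = right
    first rightIn = right
    first∈neighbours : ∀ i → first i ∈ₗ neighbours i
    first∈neighbours = from-yes (Fin.all? λ i → Any.any? (first i ≟ₛ_) (neighbours i))

  incident-edge : ∀ w → ∃[ e ] (proj₁ (Graph.ends G e) ≡ w ⊎ proj₂ (Graph.ends G e) ≡ w)
  incident-edge w with some-neighbour (decode w)
  ... | y , w~y with subst (decode w ~_) (sym (decode-encode y)) w~y
  ...   | adj with Fin.<-cmp w (encode y)
  ...     | tri< w<y _ _ = ((w , encode y) , w<y , adj) , inj₁ refl
  ...     | tri> _ _ y<w = ((encode y , w) , y<w , ~-sym adj) , inj₂ refl
  ...     | tri≈ _ w≡y _ = contradiction (subst (decode w ~_) (cong decode (sym w≡y)) adj) ~-irrefl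

  -- A vertex on e that is not an end of e would be a crossing with an edge at that vertex.
  avoids-vertices : ∀ e w → On e (position w) → EndOf e (position w)
  avoids-vertices e w on-e with incident-edge w
  ... | f , at-w with Product.≡-dec Fin._≟_ Fin._≟_ (Graph.ends G e) (Graph.ends G f)
  ...   | no e≢f = proj₁ (no-crossings e f e≢f (position w) on-e (on-f at-w))
    where
    on-f : proj₁ (Graph.ends G f) ≡ w ⊎ proj₂ (Graph.ends G f) ≡ w → On f (position w)
    on-f (inj₁ refl) = start-OnSegment (source f) (target f)
    on-f (inj₂ refl) = OnSegment-sym {target f} {source f} (start-OnSegment (target f) (source f))
  ...   | yes e≡f = Sum.map (λ eq → cong position (trans (sym eq) (cong proj₁ (sym e≡f))))
                            (λ eq → cong position (trans (sym eq) (cong proj₂ (sym e≡f)))) at-w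

  position-injective : Injective _≡_ _≡_ position
  position-injective eq = decode-injective (pos-injective _ _ eq)

  planar : Planar G
  planar = D , record
    { position-injective = position-injective
    ; arcs = λ ((u , v) , u<v , _) eq → ℕ.<-irrefl (cong toℕ (position-injective eq)) u<v
    ; avoids-vertices = avoids-vertices
    ; no-crossings = no-crossings
    }

-- List assignment

takeFirst : ∀ {c} → ℕ → Subset c → Subset c
takeFirst zero _ = Subset.⊥
takeFirst (suc m) [] = []
takeFirst (suc m) (outside ∷ S) = outside ∷ takeFirst (suc m) S
takeFirst (suc m) (inside ∷ S) = inside ∷ takeFirst m S

-- The palette is cut into {0,...,7}, {8,9,10} and {11,12,13}; the last two serve as M and M' in
-- every lens.
eight low high : Subset 14
eight = takeFirst 8 Subset.⊤
low = takeFirst 11 Subset.⊤ ─ eight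
high = Subset.⊤ ─ takeFirst 11 Subset.⊤

share : Fin 2 → Fin 14 → Fin 14 → Subset 14
share 0F a b = takeFirst 3 (eight Subset.- a Subset.- b)
share 1F a b = (eight Subset.- a Subset.- b) ─ takeFirst 3 (eight Subset.- a Subset.- b)

-- The lens of the colour pair (a , b) consists of the columns lens a b and suc (lens a b), and
-- colour₀ and colour₁ recover a and b from either of them.
lens : Fin 14 → Fin 14 → ℕ
lens a b = 2 ℕ.* (8 ℕ.* toℕ a ℕ.+ toℕ b)

colour₀ colour₁ : ℕ → Fin 14
colour₀ t = (t ℕ./ 2 ℕ./ 8) mod 14
colour₁ t = (t ℕ./ 2 ℕ.% 8) mod 14

pick : Fin 2 → Fin 14 → Fin 14 → Fin 14
pick 0F a b = a
pick 1F a b = b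

-- The number is the parity of the column: the even column of a lens ends at the middle mid, the odd
-- one starts there.
leftColours rightColours : ℕ → Fin 2 → Fin 14 → Fin 14 → Subset 14
leftColours 0 s a b = share s a b
leftColours (suc _) _ _ _ = high
rightColours 0 _ _ _ = low
rightColours (suc _) s a b = share s a b

innerList : Fin 14 → Subset 14 → Subset 14 → Fin 5 → Subset 14
innerList a S S' hub = S ∪ S'
innerList a S S' leftTop = S ∪ ⁅ a ⁆
innerList a S S' leftIn = S
innerList a S S' rightTop = S' ∪ ⁅ a ⁆
innerList a S S' rightIn = S'

cellList : ℕ → Fin 14 → Fin 14 → Fin 2 → Fin 5 → Subset 14
cellList r a b s = innerList (pick s a b) (leftColours r s a b) (rightColours r s a b)

-- The lens of a pair a ≡ b is not used, so in that case the list only has to be large enough.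
midList : ℕ → Fin 14 → Fin 14 → Subset 14
midList 0 _ _ = eight
midList (suc _) a b with a Fin.≟ b
... | yes _ = eight
... | no _ = (⁅ a ⁆ ∪ ⁅ b ⁆) ∪ (low ∪ high)

odd-midList : ∀ {x a b} → a ≢ b → x ∈ midList 1 a b → x ≢ a → x ≢ b → x ∈ low ⊎ x ∈ high
odd-midList {x} {a} {b} a≢b x∈ x≢a x≢b with a Fin.≟ b
... | yes a≡b = contradiction a≡b a≢b
... | no _ = Sum.[ (λ x∈ab → contradiction (x∈p∪q⁻ ⁅ a ⁆ ⁅ b ⁆ x∈ab) Sum.[ x≢a ∘ x∈⁅y⁆⇒x≡y a , x≢b ∘ x∈⁅y⁆⇒x≡y b ])
                 , x∈p∪q⁻ low high ] (x∈p∪q⁻ (⁅ a ⁆ ∪ ⁅ b ⁆) (low ∪ high) x∈)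

opaque
  -- The mids of odd index are the middles of lenses, with 2 + 3 + 3 colours if `a` and `b` differ.
  -- The 128 columns have 129 mids, and the last index is even.
  midList-size : ∀ (k : Fin 129) → 8 ℕ.≤ ∣ midList (toℕ k ℕ.% 2) (colour₀ (toℕ k)) (colour₁ (toℕ k)) ∣
  midList-size = from-yes (Fin.all? {n = 129} λ k →
    8 ℕ.≤? ∣ midList (toℕ k ℕ.% 2) (colour₀ (toℕ k)) (colour₁ (toℕ k)) ∣)

  -- `share s a b` contains neither `a` nor `b` and, as a part of `eight`, is disjoint from `low`
  -- and `high`. So there are at least 3 + 3 colours at the hub and 3 + 1 at the tops.
  cellList-size : ∀ (j : Fin 128) s i →
    length (neighbours i) ℕ.≤ ∣ cellList (toℕ j ℕ.% 2) (colour₀ (toℕ j)) (colour₁ (toℕ j)) s i ∣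
  cellList-size = from-yes (Fin.all? {n = 128} λ j → Fin.all? λ s → Fin.all? λ i →
    length (neighbours i) ℕ.≤? ∣ cellList (toℕ j ℕ.% 2) (colour₀ (toℕ j)) (colour₁ (toℕ j)) s i ∣)

  -- For `a ≡ b` seven colours would remain, and `share 1F a b` would have four.
  share-size : ∀ s a b → a ∈ eight → b ∈ eight → a ≢ b → ∣ share s a b ∣ ℕ.≤ 3
  share-size = from-yes (Fin.all? λ s → Fin.all? λ a → Fin.all? λ b →
    (a ∈? eight) →-dec ((b ∈? eight) →-dec (¬? (a Fin.≟ b) →-dec (∣ share s a b ∣ ℕ.≤? 3))))

Column : ℕ → ℕ → Fin 14 → Fin 14 → Set
Column t r a b = t ℕ.% 2 ≡ r × colour₀ t ≡ a × colour₁ t ≡ b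

column? : ∀ t r a b → Dec (Column t r a b)
column? t r a b = (t ℕ.% 2 ℕ.≟ r) ×-dec (colour₀ t Fin.≟ a) ×-dec (colour₁ t Fin.≟ b)

opaque
  -- The largest value of `lens` is 2 (8 · 7 + 7) = 126, so both columns of every lens exist. The
  -- last component makes the mid at the right end an even one.
  lens-columns : ∀ a b → a ∈ eight → b ∈ eight →
    suc (lens a b) ℕ.< 128 × Column (lens a b) 0 a b × Column (suc (lens a b)) 1 a b ×
    suc (suc (lens a b)) ℕ.% 2 ≡ 0
  lens-columns = from-yes (Fin.all? λ a → Fin.all? λ b → (a ∈? eight) →-dec ((b ∈? eight) →-dec
    ((suc (lens a b) ℕ.<? 128) ×-dec column? (lens a b) 0 a b ×-dec column? (suc (lens a b)) 1 a b ×-dec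
     (suc (suc (lens a b)) ℕ.% 2 ℕ.≟ 0))))

share-cover : ∀ {x a b} → x ∈ eight → x ≢ a → x ≢ b → ∃[ s ] x ∈ share s a b
share-cover {x} {a} {b} x∈ x≢a x≢b with x ∈? share 0F a b
... | yes x∈share = 0F , x∈share
... | no x∉share = 1F , x∈p∧x∉q⇒x∈p─q (x∈p∧x≢y⇒x∈p-y (x∈p∧x≢y⇒x∈p-y x∈ x≢a) x≢b) x∉share

-- Refuting choosability

module _ where
  -- Two columns for each of the 8 · 8 ordered pairs of apex colours.
  open Columns 128

  listOf : V → Subset 14
  listOf (apex s) = eight
  listOf (mid k) = midList (toℕ k ℕ.% 2) (colour₀ (toℕ k)) (colour₁ (toℕ k))
  listOf (cell j s i) = cellList (toℕ j ℕ.% 2) (colour₀ (toℕ j)) (colour₁ (toℕ j)) s i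

  L : ListAssignment G 14
  L v = listOf (decode v)

  listOf-size : ∀ d x → (∀ {j s i} → x ≡ cell j s i → d ℕ.≤ length (neighbours i)) → 8 ℕ.⊓ d ℕ.≤ ∣ listOf x ∣
  listOf-size d (apex s) _ = ℕ.m⊓n≤m 8 d
  listOf-size d (mid k) _ = ℕ.≤-trans (ℕ.m⊓n≤m 8 d) (midList-size k)
  listOf-size d (cell j s i) d≤ = ℕ.≤-trans (ℕ.m⊓n≤n 8 d) (ℕ.≤-trans (d≤ refl) (cellList-size j s i))

  L-size : IsListAssignmentFor G (λ v → 8 ℕ.⊓ Graph.degree G v) L
  L-size v = listOf-size (Graph.degree G v) (decode v) (degree-cell v)

  module Colouring
    (c : V → Fin 14) (c∈ : ∀ x → c x ∈ listOf x) (c-proper : ∀ {x y} → x ~ y → c x ≢ c y) where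

    ∪⁅⁆-≢ : ∀ {x a} (S : Subset 14) → x ∈ S ∪ ⁅ a ⁆ → x ≢ a → x ∈ S
    ∪⁅⁆-≢ S x∈ x≢a = Sum.[ (λ x∈S → x∈S) , (λ x∈a → contradiction (x∈⁅y⁆⇒x≡y _ x∈a) x≢a) ] (x∈p∪q⁻ S _ x∈)

    four-in-three : ∀ {S : Subset 14} {w x y z} → ∣ S ∣ ℕ.≤ 3 →
                    w ~ x → w ~ y → w ~ z → x ~ y → x ~ z → y ~ z →
                    c w ∈ S → c x ∈ S → c y ∈ S → c z ∉ S
    four-in-three {S} ∣S∣≤3 wx wy wz xy xz yz w∈ x∈ y∈ z∈ = contradiction
      (unique⇒length≤∣ S ∣
        ((c-proper wx ∷ c-proper wy ∷ c-proper wz ∷ []) ∷ (c-proper xy ∷ c-proper xz ∷ []) ∷ (c-proper yz ∷ []) ∷ [] ∷ [])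
        (w∈ ∷ x∈ ∷ y∈ ∷ z∈ ∷ []))
      (ℕ.<⇒≱ (s≤s ∣S∣≤3))

    -- Each mid forms a clique of order 4 with its pair and the hub. The apex bars `a` from the top
    -- vertex, so the mid and its pair have colours in `S`, and `four-in-three` keeps the hub out of
    -- `S`; likewise for `S'` on the right.
    bad-cell : ∀ {S S' : Subset 14} j s → ∣ S ∣ ℕ.≤ 3 → ∣ S' ∣ ℕ.≤ 3 →
               (∀ i → c (cell j s i) ∈ innerList (c (apex s)) S S' i) →
               c (place j s left) ∈ S → c (place j s right) ∉ S'
    bad-cell {S} {S'} j s ∣S∣≤3 ∣S'∣≤3 inner∈ left∈ right∈ = Sum.[ hub∉S , hub∉S' ] (x∈p∪q⁻ S S' (inner∈ hub))
      where
      adj : ∀ i {σ} → σ ∈ₗ neighbours i → cell j s i ~ place j s σ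
      adj i = neighbour-adj

      hub∉S : c (cell j s hub) ∉ S
      hub∉S = four-in-three ∣S∣≤3
        (~-sym (adj leftTop (there (here refl)))) (~-sym (adj leftIn (here refl))) (~-sym (adj hub (here refl)))
        (adj leftTop (there (there (here refl)))) (adj leftTop (there (there (there (here refl)))))
        (adj leftIn (there (there (here refl))))
        left∈ (∪⁅⁆-≢ S (inner∈ leftTop) (c-proper (adj leftTop (here refl)))) (inner∈ leftIn)

      hub∉S' : c (cell j s hub) ∉ S'
      hub∉S' = four-in-three ∣S'∣≤3
        (~-sym (adj rightTop (there (here refl)))) (~-sym (adj rightIn (here refl))) (~-sym (adj hub (there (here refl))))
        (adj rightTop (there (there (here refl)))) (adj rightTop (there (there (there (here refl)))))
        (adj rightIn (there (there (here refl))))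
        right∈ (∪⁅⁆-≢ S' (inner∈ rightTop) (c-proper (adj rightTop (here refl)))) (inner∈ rightIn)

    inner∈ : ∀ {r a b} j s → Column (toℕ j) r a b → ∀ i → c (cell j s i) ∈ cellList r a b s i
    inner∈ j s (refl , refl , refl) i = c∈ (cell j s i)

    mid∈ : ∀ {r a b} k → Column (toℕ k) r a b → c (mid k) ∈ midList r a b
    mid∈ k (refl , refl , refl) = c∈ (mid k)

    contradictory : ⊥
    -- `s₁` is the side whose share holds the colour of the last mid of the lens; the cell after the
    -- middle mid on that side gives the contradiction.
    contradictory = bad-cell j₁ s₁ (ℕ.≤-refl {3}) (share-size s₁ a b a∈ b∈ a≢b)
      (λ i → subst (λ x → c (cell j₁ s₁ i) ∈ innerList x high (share s₁ a b) i) (pick-apex s₁)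
        (inner∈ j₁ s₁ column₁ i))
      left-high (proj₂ last-cover)
      where
      a = c (apex 0F)
      b = c (apex 1F)
      a∈ : a ∈ eight
      a∈ = c∈ (apex 0F)
      b∈ : b ∈ eight
      b∈ = c∈ (apex 1F)
      a≢b : a ≢ b
      a≢b = c-proper (base , inj₁ (refl , refl))

      pick-apex : ∀ s → pick s a b ≡ c (apex s)
      pick-apex 0F = refl
      pick-apex 1F = refl

      t = lens a b
      facts = lens-columns a b a∈ b∈
      1+t<128 = proj₁ facts

      j₀ j₁ : Fin 128
      j₀ = fromℕ< (ℕ.<-trans (ℕ.n<1+n t) 1+t<128)
      j₁ = fromℕ< 1+t<128

      toℕ-j₀ : toℕ j₀ ≡ t
      toℕ-j₀ = Fin.toℕ-fromℕ< _
      toℕ-j₁ : toℕ j₁ ≡ suc t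
      toℕ-j₁ = Fin.toℕ-fromℕ< 1+t<128

      column₀ : Column (toℕ j₀) 0 a b
      column₀ = subst (λ t → Column t 0 a b) (sym toℕ-j₀) (proj₁ (proj₂ facts))
      column₁ : Column (toℕ j₁) 1 a b
      column₁ = subst (λ t → Column t 1 a b) (sym toℕ-j₁) (proj₁ (proj₂ (proj₂ facts)))

      even-mid : ∀ k → toℕ k ℕ.% 2 ≡ 0 → ∃[ s ] c (mid k) ∈ share s a b
      even-mid k even = share-cover
        (subst (λ r → c (mid k) ∈ midList r (colour₀ (toℕ k)) (colour₁ (toℕ k))) even (c∈ (mid k)))
        (c-proper (spoke 0F k , inj₂ (refl , refl))) (c-proper (spoke 1F k , inj₂ (refl , refl)))

      -- Mids do not depend on the side, so `0F` serves until the share determines the side `s₀`.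
      first-cover : ∃[ s ] c (place j₀ 0F left) ∈ share s a b
      first-cover = even-mid (inject₁ j₀) (trans (cong (ℕ._% 2) (Fin.toℕ-inject₁ j₀)) (proj₁ column₀))

      last-cover : ∃[ s ] c (place j₁ 0F right) ∈ share s a b
      last-cover = even-mid (suc j₁) (trans (cong (λ t → suc t ℕ.% 2) toℕ-j₁) (proj₂ (proj₂ (proj₂ facts))))

      s₀ = proj₁ first-cover
      s₁ = proj₁ last-cover

      middle : Fin 129
      middle = inject₁ j₁

      middle≡ : suc j₀ ≡ middle
      middle≡ = Fin.toℕ-injective (trans (cong suc toℕ-j₀) (sym (trans (Fin.toℕ-inject₁ j₁) toℕ-j₁)))

      not-low : c (mid middle) ∉ low
      not-low = subst (λ k → c (mid k) ∉ low) middle≡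
        (bad-cell j₀ s₀ (share-size s₀ a b a∈ b∈ a≢b) (ℕ.≤-refl {3})
          (λ i → subst (λ x → c (cell j₀ s₀ i) ∈ innerList x (share s₀ a b) low i) (pick-apex s₀)
            (inner∈ j₀ s₀ column₀ i))
          (proj₂ first-cover))

      -- The apexes bar `a` and `b` from the middle mid, and the cell before it bars `low`.
      left-high : c (mid middle) ∈ high
      left-high = Sum.[ (λ x∈low → contradiction x∈low not-low) , (λ x∈high → x∈high) ]′
        (odd-midList a≢b (mid∈ middle (subst (λ t → Column t 1 a b) (sym (Fin.toℕ-inject₁ j₁)) column₁))
          (c-proper (spoke 0F middle , inj₂ (refl , refl))) (c-proper (spoke 1F middle , inj₂ (refl , refl))))

  not-choosable : ¬ DegreeTruncatedChoosable 8 G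
  not-choosable choosable = Colouring.contradictory (φ ∘ encode) φ∈ φ-proper
    where
    φ = proj₁ (choosable L L-size)
    φ∈ : ∀ x → φ (encode x) ∈ listOf x
    φ∈ x = subst (λ y → φ (encode x) ∈ listOf y) (decode-encode x)
      (proj₁ (proj₂ (choosable L L-size)) (encode x))
    φ-proper : ∀ {x y} → x ~ y → φ (encode x) ≢ φ (encode y)
    φ-proper x~y = proj₂ (proj₂ (choosable L L-size)) (encode-adj x~y)

  -- The tail of an arc is an apex or an inner vertex, never a mid.
  mids-not-adjacent : ∀ {k k'} → ¬ mid k ~ mid k'
  mids-not-adjacent (base , inj₁ (() , _))
  mids-not-adjacent (base , inj₂ (() , _))
  mids-not-adjacent (spoke _ _ , inj₁ (() , _))
  mids-not-adjacent (spoke _ _ , inj₂ (() , _))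
  mids-not-adjacent (bond _ _ _ , inj₁ (() , _))
  mids-not-adjacent (bond _ _ _ , inj₂ (() , _))

  not-complete : ¬ Complete G
  not-complete complete = mids-not-adjacent {zero} {suc zero} (subst₂ _~_ (decode-encode _) (decode-encode _)
    (complete {encode (mid zero)} {encode (mid (suc zero))} λ eq → contradiction (encode-injective eq) λ ()))

theorem1 : Σ[ G ∈ Graph ] ( 3 -Connected G × Planar G × ¬ Complete G × ¬ DegreeTruncatedChoosable 8 G )
theorem1 =
  Columns.G 128 , Columns.3-connected 128 (s≤s z≤n) , Columns.planar 128 , not-complete , not-choosable
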